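{- Let $w$ be the weight system on the lecture hall graph defined by \[ w(t;i,j)=(-aq^{2i+1})^t\,q^j\qquad(t\ge0,\ 0\le j\le i). \] Then the mixed moments $\sigma^b_{n,k}(a;q)$ of the $q$-Bessel polynomials satisfy \[ \sigma^b_{n,k}(a;q)=h^w_{n,k}\qquad(n\ge k\ge0). \]
   Context: Lecture hall graph. For integers $t\ge0$, $0\le j\le i$ put $v^t_{i,j}=(i,\,t+\frac{j}{i+1})$, and set $v^t_{i,i+1}:=v^{t+1}_{i,0}$. The vertices of the lecture hall graph are all $v^t_{i,j}$; its edges join $v^t_{i,j}$ with $v^t_{i,j+1}$ (vertical edges) and $v^t_{i,j}$ with $v^t_{i+1,j}$, for $t\ge 0$, $0\le j\le i$. An east step is a directed edge $(v^t_{i,j},v^t_{i+1,j})$; a south step is a vertical edge directed downwards, $(v^t_{i,j+1},v^t_{i,j})$. A weight system $w$ assigns a weight $w(t;i,j)$ to each east step $(v^t_{i,j},v^t_{i+1,j})$. The weight $w(p)$ of a path is the product of the weights of its east steps. $\mathrm{SE}((k,\infty)\to(n,0))$ is the set of paths $(\dots,v_2,v_1,v_0)$ with $v_0=(n,0)$, $\lim_{m\to\infty}v_m=(k,\infty)$, and each $(v_{m+1},v_m)$ a south or east step. Define $h^w_{n,k}=\sum_{p\in \mathrm{SE}((k,\infty)\to(n,0))}w(p)$ (so $h^w_{n,n}=1$). $q$-Bessel polynomials. The monic $q$-Bessel (alternative $q$-Charlier) polynomials are \[ p_n(x;a;q)=\frac{1}{(-1)^nq^{ -\binom n2}(-aq^n;q)_n}\;{}_2\phi_1\!\left(\begin{matrix}q^{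 -n},-aq^n\\0\end{matrix};q,qx\right), \] where ${}_2\phi_1(\alpha_1,\alpha_2;\beta;q,z)=\sum_{k\ge0}\frac{(\alpha_1;q)_k(\alpha_2;q)_k}{(q;q)_k(\beta;q)_k}z^k$ and $(z;q)_k=\prod_{i=0}^{k-1}(1-zq^i)$. The mixed moments are defined by $x^n=\sum_{k=0}^n\sigma^b_{n,k}(a;q)\,p_k(x;a;q)$. Here $a,q$ are indeterminates, and the identity is one of formal power series in $a$ with coefficients in $\mathbb{Q}(q)$ (the infinite sum $h^w_{n,k}$ gives the power series expansion of the rational function $\sigma^b_{n,k}(a;q)$). -}

module Defs where

open import Algebra.Bundles.Raw using (RawRing)
import Algebra.Definitions.RawSemiring as RawSemiringOps
open import Data.Empty using (⊥-elim)
open import Data.Fin.Base using (Fin; toℕ) renaming (zero to fzero; suc to fsuc)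
open import Data.Integer.Base using (+_)
open import Data.List.Base using (List; foldr; map)
import Data.List.Membership.Setoid as Membership
import Data.List.Relation.Unary.Unique.Setoid as Unique
open import Data.Nat.Base as ℕ using (ℕ; zero; suc; _∸_; _≤_; _⊔_; z≤n; s≤s)
open import Data.Nat.Combinatorics using (_C_)
import Data.Nat.Properties as ℕₚ
open import Data.Product.Base using (_×_; _,_; proj₁; proj₂; ∃; Σ-syntax; ∃-syntax)
open import Data.Rational.Base as ℚ using (ℚ; 0ℚ; 1ℚ)
import Data.Rational.Properties as ℚₚ
open import Data.Sum.Base using (inj₁; inj₂)
open import Data.Vec.Functional using (Vector)
open import Function.Base using (_∘_)
open import Level using (0ℓ)
open import Relation.Binary.Bundles using (Setoid)
import Relation.Binary.Construct.On as On
open import Relation.Binary.PropositionalEquality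
  using (_≡_; _≢_; refl; sym; trans; cong; cong₂; subst; _→-setoid_)
open import Relation.Nullary.Decidable using (Dec; yes; no; ¬?)

------------------------------------------------------------------------
-- Formal power series R⟦X⟧, as coefficient sequences

module PowerSeries (R : RawRing 0ℓ 0ℓ) where

  open RawRing R
  open RawSemiringOps rawSemiring using (sum)

  Series : Set
  Series = ℕ → Carrier

  constant : Carrier → Series
  constant c zero    = c
  constant c (suc n) = 0#

  X : Series
  X 1 = 1#
  X _ = 0#

  infixl 7 _⊛_
  _⊛_ : Series → Series → Series
  (f ⊛ g) n = sum {suc n} λ i → f (toℕ i) * g (n ∸ toℕ i)

  rawRing : RawRing 0ℓ 0ℓ
  rawRing = record
    { Carrier = Series
    ; _≈_     = λ f g → ∀ n → f n ≈ g n
    ; _+_     = λ f g n → f n + g n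
    ; _*_     = _⊛_
    ; -_      = λ f n → - f n
    ; 0#      = constant 0#
    ; 1#      = constant 1#
    }

  -- With c = f 0 invertible, f⁻¹ = c⁻¹ · Σₖ (1 − c⁻¹ f)ᵏ.  The series
  -- 1 − c⁻¹ f has no constant term, so only k ≤ n reach the coefficient of Xⁿ.
  inverse : (Carrier → Carrier) → Series → Series
  inverse _⁻¹ f n = (f 0 ⁻¹) * sum {suc n} λ k → (u ^ toℕ k) n
    where
    module S = RawRing rawRing
    open RawSemiringOps S.rawSemiring using (_^_)
    u : Series
    u = S.1# S.+ (S.- (constant (f 0 ⁻¹) ⊛ f))

------------------------------------------------------------------------
-- The field ℚ(q) of rational functions.  ℚ[q] is the set of finitely
-- supported series in ℚ⟦q⟧.

module ℚ⟦q⟧ = PowerSeries ℚ.+-*-rawRing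

private
  module ℚ∑ = RawSemiringOps (RawRing.rawSemiring ℚ.+-*-rawRing)

record ℚ[q] : Set where
  constructor poly
  field
    coeff  : ℕ → ℚ
    bound  : ℕ
    vanish : ∀ n → bound ≤ n → coeff n ≡ 0ℚ

open ℚ[q] public

infix 4 _≈ₚ_
_≈ₚ_ : ℚ[q] → ℚ[q] → Set
f ≈ₚ g = ∀ n → coeff f n ≡ coeff g n

NonZeroSeries : (ℕ → ℚ) → Set
NonZeroSeries f = ∃[ n ] f n ≢ 0ℚ

private
  sum-zero : ∀ {n} (t : Vector ℚ n) → (∀ i → t i ≡ 0ℚ) → ℚ∑.sum t ≡ 0ℚ
  sum-zero {zero}  t t≡0 = refl
  sum-zero {suc n} t t≡0 =
    cong₂ ℚ._+_ (t≡0 fzero) (sum-zero (t ∘ fsuc) (t≡0 ∘ fsuc))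

  ⊛-vanish : ∀ f g N M →
    (∀ n → N ≤ n → f n ≡ 0ℚ) → (∀ n → M ≤ n → g n ≡ 0ℚ) →
    ∀ n → N ℕ.+ M ≤ n → (f ℚ⟦q⟧.⊛ g) n ≡ 0ℚ
  ⊛-vanish f g N M f≡0 g≡0 n N+M≤n = sum-zero {suc n} _ term
    where
    term : ∀ (i : Fin (suc n)) → f (toℕ i) ℚ.* g (n ∸ toℕ i) ≡ 0ℚ
    term i with N ℕₚ.≤? toℕ i
    ... | yes N≤i = trans (cong (ℚ._* g (n ∸ toℕ i)) (f≡0 (toℕ i) N≤i))
                          (ℚₚ.*-zeroˡ (g (n ∸ toℕ i)))
    ... | no  N≰i = trans (cong (f (toℕ i) ℚ.*_) (g≡0 (n ∸ toℕ i) M≤n∸i))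
                          (ℚₚ.*-zeroʳ (f (toℕ i)))
      where
      M≤n∸i : M ≤ n ∸ toℕ i
      M≤n∸i = ℕₚ.m+n≤o⇒m≤o∸n M
        (ℕₚ.≤-trans (ℕₚ.≤-reflexive (ℕₚ.+-comm M (toℕ i)))
        (ℕₚ.≤-trans (ℕₚ.+-monoˡ-≤ M (ℕₚ.<⇒≤ (ℕₚ.≰⇒> N≰i))) N+M≤n))

  *-≢0 : ∀ {x y} → x ≢ 0ℚ → y ≢ 0ℚ → x ℚ.* y ≢ 0ℚ
  *-≢0 {x} {y} x≢0 y≢0 xy≡0 = y≢0
    (trans (sym (ℚₚ.*-identityˡ y))
    (trans (cong (ℚ._* y) (sym (ℚₚ.*-inverseˡ x)))
    (trans (ℚₚ.*-assoc (ℚ.1/ x) x y)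
    (trans (cong (ℚ.1/ x ℚ.*_) xy≡0) (ℚₚ.*-zeroʳ (ℚ.1/ x))))))
    where instance _ = ℚ.≢-nonZero x≢0

  ⊛-shiftˡ : ∀ f g → f 0 ≡ 0ℚ → ∀ n →
    (f ℚ⟦q⟧.⊛ g) (suc n) ≡ ((f ∘ suc) ℚ⟦q⟧.⊛ g) n
  ⊛-shiftˡ f g f₀≡0 n = trans
    (cong (ℚ._+ ((f ∘ suc) ℚ⟦q⟧.⊛ g) n)
      (trans (cong (ℚ._* g (suc n)) f₀≡0) (ℚₚ.*-zeroˡ (g (suc n)))))
    (ℚₚ.+-identityˡ _)

  ⊛-shiftʳ : ∀ f g → g 0 ≡ 0ℚ → ∀ n →
    (f ℚ⟦q⟧.⊛ g) (suc n) ≡ (f ℚ⟦q⟧.⊛ (g ∘ suc)) n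
  ⊛-shiftʳ f g g₀≡0 zero = cong (f 0 ℚ.* g 1 ℚ.+_)
    (trans (ℚₚ.+-identityʳ _) (trans (cong (f 1 ℚ.*_) g₀≡0) (ℚₚ.*-zeroʳ (f 1))))
  ⊛-shiftʳ f g g₀≡0 (suc n) =
    cong (f 0 ℚ.* g (suc (suc n)) ℚ.+_) (⊛-shiftʳ (f ∘ suc) g g₀≡0 n)

  ⊛-nonZero : ∀ f g m l → f m ≢ 0ℚ → g l ≢ 0ℚ → NonZeroSeries (f ℚ⟦q⟧.⊛ g)
  ⊛-nonZero f g m l f≢0 g≢0 with f 0 ℚₚ.≟ 0ℚ | g 0 ℚₚ.≟ 0ℚ
  ⊛-nonZero f g zero    l f≢0 g≢0 | yes f₀≡0 | _ = ⊥-elim (f≢0 f₀≡0)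
  ⊛-nonZero f g (suc m) l f≢0 g≢0 | yes f₀≡0 | _
    with n , p ← ⊛-nonZero (f ∘ suc) g m l f≢0 g≢0
    = suc n , p ∘ trans (sym (⊛-shiftˡ f g f₀≡0 n))
  ⊛-nonZero f g m zero    f≢0 g≢0 | no _ | yes g₀≡0 = ⊥-elim (g≢0 g₀≡0)
  ⊛-nonZero f g m (suc l) f≢0 g≢0 | no _ | yes g₀≡0
    with n , p ← ⊛-nonZero f (g ∘ suc) m l f≢0 g≢0
    = suc n , p ∘ trans (sym (⊛-shiftʳ f g g₀≡0 n))
  ⊛-nonZero f g m l f≢0 g≢0 | no f₀≢0 | no g₀≢0 =
    0 , *-≢0 f₀≢0 g₀≢0 ∘ trans (sym (ℚₚ.+-identityʳ _))

infixl 6 _+ₚ_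
_+ₚ_ : ℚ[q] → ℚ[q] → ℚ[q]
f +ₚ g = poly (λ n → coeff f n ℚ.+ coeff g n) (bound f ⊔ bound g) λ n b≤n →
  cong₂ ℚ._+_ (vanish f n (ℕₚ.m⊔n≤o⇒m≤o _ _ b≤n))
              (vanish g n (ℕₚ.m⊔n≤o⇒n≤o (bound f) _ b≤n))

infixl 7 _*ₚ_
_*ₚ_ : ℚ[q] → ℚ[q] → ℚ[q]
f *ₚ g = poly (coeff f ℚ⟦q⟧.⊛ coeff g) (bound f ℕ.+ bound g)
  (⊛-vanish (coeff f) (coeff g) (bound f) (bound g) (vanish f) (vanish g))

infix 8 -ₚ_
-ₚ_ : ℚ[q] → ℚ[q]
-ₚ f = poly (λ n → ℚ.- coeff f n) (bound f) λ n b≤n → cong ℚ.-_ (vanish f n b≤n)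

0ₚ 1ₚ qₚ : ℚ[q]
0ₚ = poly (ℚ⟦q⟧.constant 0ℚ) 0 λ { zero _ → refl ; (suc _) _ → refl }
1ₚ = poly (ℚ⟦q⟧.constant 1ℚ) 1 λ { (suc _) _ → refl }
qₚ = poly ℚ⟦q⟧.X 2 λ { (suc zero) (s≤s ()) ; (suc (suc _)) _ → refl }

NonZeroₚ : ℚ[q] → Set
NonZeroₚ f = NonZeroSeries (coeff f)

nonZeroₚ? : (f : ℚ[q]) → Dec (NonZeroₚ f)
nonZeroₚ? f with ℕₚ.anyUpTo? (λ n → ¬? (coeff f n ℚₚ.≟ 0ℚ)) (bound f)
... | yes (n , _ , fn≢0) = yes (n , fn≢0)
... | no  none           = no λ (n , fn≢0) →
  none (n , ℕₚ.≰⇒> (fn≢0 ∘ vanish f n) , fn≢0)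

*ₚ-nonZero : ∀ f g → NonZeroₚ f → NonZeroₚ g → NonZeroₚ (f *ₚ g)
*ₚ-nonZero f g (m , f≢0) (l , g≢0) =
  ⊛-nonZero (coeff f) (coeff g) m l f≢0 g≢0

1ₚ-nonZero : NonZeroₚ 1ₚ
1ₚ-nonZero = 0 , λ ()

record ℚ⟨q⟩ : Set where
  constructor frac
  field
    num         : ℚ[q]
    den         : ℚ[q]
    den-nonZero : NonZeroₚ den

open ℚ⟨q⟩ public

infix 4 _≈ᶠ_
_≈ᶠ_ : ℚ⟨q⟩ → ℚ⟨q⟩ → Set
x ≈ᶠ y = num x *ₚ den y ≈ₚ num y *ₚ den x

fromPoly : ℚ[q] → ℚ⟨q⟩
fromPoly f = frac f 1ₚ 1ₚ-nonZero

ℚ⟨q⟩-rawRing : RawRing 0ℓ 0ℓ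
ℚ⟨q⟩-rawRing = record
  { Carrier = ℚ⟨q⟩
  ; _≈_     = _≈ᶠ_
  ; _+_     = λ x y → frac (num x *ₚ den y +ₚ num y *ₚ den x) (den x *ₚ den y)
                (*ₚ-nonZero (den x) (den y) (den-nonZero x) (den-nonZero y))
  ; _*_     = λ x y → frac (num x *ₚ num y) (den x *ₚ den y)
                (*ₚ-nonZero (den x) (den y) (den-nonZero x) (den-nonZero y))
  ; -_      = λ x → frac (-ₚ num x) (den x) (den-nonZero x)
  ; 0#      = fromPoly 0ₚ
  ; 1#      = fromPoly 1ₚ
  }

-- Total, with 0⁻¹ = 0; it is only ever applied to nonzero elements below.
infix 8 _⁻¹
_⁻¹ : ℚ⟨q⟩ → ℚ⟨q⟩
x ⁻¹ with nonZeroₚ? (num x)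
... | yes num≢0 = frac (den x) (num x) num≢0
... | no  _     = fromPoly 0ₚ

------------------------------------------------------------------------
-- The lecture hall graph

-- ⟨ t , i , j ⟩ is the vertex v^t_{i,j} = (i , t + j/(i+1)) with 0 ≤ j ≤ i.
record Vertex : Set where
  constructor ⟨_,_,_⟩
  field
    t i j  : ℕ
    .{j≤i} : j ≤ i

column : Vertex → ℕ
column = Vertex.i

height : Vertex → ℚ
height ⟨ t , i , j ⟩ = + t ℚ./ 1 ℚ.+ + j ℚ./ suc i

-- Directed steps.  The constructor south₀ is the case j = i of the south step
-- (v^t_{i,j+1} , v^t_{i,j}), where v^t_{i,i+1} means v^{t+1}_{i,0}.
data Step : Vertex → Vertex → Set where
  east   : ∀ {t i j} .{p : j ≤ i} .{p′ : j ≤ suc i} →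
           Step (⟨ t , i , j ⟩ {p}) (⟨ t , suc i , j ⟩ {p′})
  south  : ∀ {t i j} .{p : suc j ≤ i} .{p′ : j ≤ i} →
           Step (⟨ t , i , suc j ⟩ {p}) (⟨ t , i , j ⟩ {p′})
  south₀ : ∀ {t i} .{p : 0 ≤ i} .{p′ : i ≤ i} →
           Step (⟨ suc t , i , 0 ⟩ {p}) (⟨ t , i , i ⟩ {p′})

-- SE k n is the set of paths (… , v₂ , v₁ , v₀) from (k , ∞) to (n , 0).
-- Columns are integers, so vₘ → (k , ∞) says that the column is eventually k
-- and the height eventually exceeds any bound.
record SE (k n : ℕ) : Set where
  field
    vertex : ℕ → Vertex
    end    : vertex 0 ≡ ⟨ 0 , n , 0 ⟩ {z≤n}
    step   : ∀ m → Step (vertex (suc m)) (vertex m)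
    limit  : ∀ (T : ℕ) → ∃[ M ] ∀ m → M ≤ m →
             column (vertex m) ≡ k × (+ T ℚ./ 1) ℚ.≤ height (vertex m)

-- Paths are equal when they visit the same vertices.
SE-setoid : ℕ → ℕ → Setoid 0ℓ 0ℓ
SE-setoid k n = On.setoid (ℕ →-setoid Vertex) (SE.vertex {k} {n})

module Weights (R : RawRing 0ℓ 0ℓ) where

  open RawRing R
  open RawSemiringOps rawSemiring using (product)

  -- w v is the weight of the east step starting at v.
  WeightSystem : Set
  WeightSystem = Vertex → Carrier

  stepWeight : WeightSystem → ∀ {u v} → Step u v → Carrier
  stepWeight w {u} east   = w u
  stepWeight w     south  = 1#
  stepWeight w     south₀ = 1#

  -- From the M-th vertex on, the path stays in column k, so that all of its
  -- east steps are among the steps (v_{m+1} , v_m) with m < M.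
  pathWeight : WeightSystem → ∀ {k n} → SE k n → Carrier
  pathWeight w p = product {M} λ m → stepWeight w (SE.step p (toℕ m))
    where M = proj₁ (SE.limit p 0)

------------------------------------------------------------------------
-- Summable families of power series: each power of X occurs in only
-- finitely many members, and the sum is taken coefficientwise.

module Summation (R : RawRing 0ℓ 0ℓ) (I : Setoid 0ℓ 0ℓ) where

  open RawRing R
  open PowerSeries R using (Series)
  open Setoid I using () renaming (Carrier to Index)
  open Membership I using (_∉_)
  open Unique I using (Unique)

  HasSum : (Index → Series) → Series → Set
  HasSum f s = ∀ m → Σ[ is ∈ List Index ]
    Unique is ×
    (∀ i → i ∉ is → f i m ≈ 0#) ×
    s m ≈ foldr _+_ 0# (map (λ i → f i m) is)

------------------------------------------------------------------------
-- q-Bessel polynomials over a ring R with elements a and q.  Polynomials in x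
-- are elements of R⟦x⟧.

module QBessel (R : RawRing 0ℓ 0ℓ) (inv : RawRing.Carrier R → RawRing.Carrier R)
               (a q : RawRing.Carrier R) where

  open RawRing R
  open RawSemiringOps rawSemiring using (_^_; product)
  open PowerSeries R using (Series; constant; X)
  private
    module R⟦x⟧ = RawRing (PowerSeries.rawRing R)
    module R⟦x⟧-ops = RawSemiringOps R⟦x⟧.rawSemiring

  qPochhammer : Carrier → ℕ → Carrier
  qPochhammer z k = product {k} λ i → 1# + - (z * q ^ toℕ i)

  -- ₂φ₁(α₁,α₂;β;q,z) as a power series in z.
  φ : (α₁ α₂ β : Carrier) → Series
  φ α₁ α₂ β k = (qPochhammer α₁ k * qPochhammer α₂ k)
              * inv (qPochhammer q k * qPochhammer β k)

  -- The k-th coefficient of p_n carries q ^ k because z = q x.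
  p : ℕ → Series
  p n k = inv ((- 1#) ^ n * inv (q ^ (n C 2)) * qPochhammer (- (a * q ^ n)) n)
        * (φ (inv (q ^ n)) (- (a * q ^ n)) 0# k * q ^ k)

  IsMixedMoments : (ℕ → ℕ → Carrier) → Set
  IsMixedMoments σ = ∀ n →
    X R⟦x⟧-ops.^ n R⟦x⟧.≈
      R⟦x⟧-ops.sum {suc n} λ k → constant (σ n (toℕ k)) R⟦x⟧.* p (toℕ k)

  open Weights R using (WeightSystem)

  besselWeight : WeightSystem
  besselWeight ⟨ t , i , j ⟩ = (- (a * q ^ (2 ℕ.* i ℕ.+ 1))) ^ t * q ^ j

------------------------------------------------------------------------
-- The ring ℚ(q)⟦a⟧

module ℚ⟨q⟩⟦a⟧ where

  open PowerSeries ℚ⟨q⟩-rawRing public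

  a q : Series
  a = X
  q = constant (fromPoly qₚ)

  open QBessel rawRing (inverse _⁻¹) a q public
  open Weights rawRing public

  -- The infinite sum h^w_{n,k} converges to s.
  h[_,_,_]≡_ : WeightSystem → ℕ → ℕ → Series → Set
  h[ w , n , k ]≡ s =
    Summation.HasSum ℚ⟨q⟩-rawRing (SE-setoid k n) (pathWeight w) s

{-# OPTIONS --safe #-}

-- Paths.  For a vertex v = v^t_{i,j} let S(v) be the sum of the weights of the paths from (k,∞)
-- to v.  Splitting off the last step gives
--     S(v^t_{i,j}) = S(v^t_{i,j+1}) + w(t;i−1,j) S(v^t_{i−1,j})   (j < i),      S = 1 for i = k,
-- and these relations determine S, because every east step at level t contributes a factor aᵗ,
-- so that modulo a power of a only finitely many paths matter.  With m = i − k and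
-- y = −a q^{2k+m} they are solved by
--     S(v^t_{i,j}) = y^{mt} / (−a q^{2k+1};q)_m · Σᵣ yʳ q^{(j−r)(m−r)} [j,r] [i−j,m−r],
-- a sum that is independent of j at y = 1 by the q-Vandermonde identity.  In particular
--     h_{n,k} = S(v^0_{n,0}) = [n,k] / (−a q^{2k+1};q)_{n−k}.
--
-- Moments.  It remains to see that (h_{n,k}) is the inverse of the coefficient matrix of the
-- polynomials p_n.  With b = −a q^{2m+1} and N = n − m > 0 the entry (n,m) of the product is,
-- up to a factor, Σₛ (q^{−N};q)ₛ/(q;q)ₛ qˢ (b qˢ;q)_{N−1}: the value at 0 of a q-difference
-- operator of order N applied to a polynomial of degree N − 1 in qˢ.

module Submission where

open import Defs
open import Data.Nat.Base using (ℕ; _≤_)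

open import Algebra.Bundles using (CommutativeRing)
open import Algebra.Bundles.Raw using (RawRing)
import Algebra.Definitions.RawSemiring as RawSemiringOps
import Algebra.Morphism.RingMonomorphism as RingMonomorphism
open import Algebra.Morphism.Structures using (IsRingMonomorphism)
import Algebra.Properties.CommutativeSemiring.Exp as Exp
import Algebra.Properties.Monoid.Sum as MonoidSum
import Algebra.Properties.Semiring.Sum as SemiringSum
open import Algebra.Structures using (IsCommutativeRing)
open import Data.Empty using (⊥-elim-irr)
open import Data.Fin.Base using (toℕ)
open import Data.Fin.Properties using (toℕ≤pred[n])
open import Data.Integer.Base as ℤ using (+_)
import Data.Integer.Properties as ℤₚ
open import Data.List.Base using (List; []; _∷_; _++_; foldr; map)
open import Data.List.Properties using (map-∘)
import Data.List.Membership.Setoid as Membership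
import Data.List.Membership.Setoid.Properties as Membershipₚ
open import Data.List.Relation.Unary.All using ([])
open import Data.List.Relation.Unary.AllPairs using ([]; _∷_)
open import Data.List.Relation.Unary.Any using (here)
import Data.List.Relation.Unary.Unique.Setoid as Unique
import Data.List.Relation.Unary.Unique.Setoid.Properties as Uniqueₚ
open import Data.Nat.Base as ℕ using (zero; suc; _∸_; _<_; z≤n; s≤s)
open import Data.Nat.Combinatorics using (_C_; nC1≡n; nCk+nC[k+1]≡[n+1]C[k+1])
import Data.Nat.Properties as ℕₚ
open import Data.Product.Base using (_×_; _,_; proj₁; proj₂; ∃; ∃-syntax)
open import Data.Rational.Base as ℚ using (ℚ; 0ℚ; 1ℚ)
import Data.Rational.Properties as ℚₚ
open import Data.Rational.Unnormalised.Base as ℚᵘ using (mkℚᵘ; *≤*)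
import Data.Rational.Unnormalised.Properties as ℚᵘₚ
open import Data.Sum.Base using (_⊎_; inj₁; inj₂)
open import Function.Base using (_∘_)
open import Level using (0ℓ)
open import Relation.Binary.Bundles using (Setoid)
import Relation.Binary.Construct.On as On
open import Relation.Binary.PropositionalEquality as ≡ using (_≡_; _≢_; _→-setoid_)
open import Relation.Nullary.Decidable using (yes; no; recompute)
open import Relation.Nullary.Negation using (¬_; contradiction)

-- The ring solver over a ring without decidable equality, with coefficients
-- in ℤ so that cancelling terms are recognised.

-- No limit is ever taken. For each power of the series variable, the paths that can contribute to
-- it form an explicit finite list, built by a lexicographic induction on the column, the level
-- (downwards from above the truncation) and the position in the level. The weight of a path is a
-- product up to the bound stored in its `limit` proof, so it is not visibly a function of the
-- vertices. Weights of equal paths are never compared: removing the last step lowers the bound by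
-- exactly one, and the recursion holds for every representative. The closed form works because
-- moving one column to the right replaces y by q y. The new denominator factor 1 - q y then cancels
-- the defect in the q-Vandermonde recursion, and the powers of y attached to the levels absorb the
-- weight of the east step. Only units can be divided by, so quotients are compared after clearing
-- denominators. The q-identities are proved over an abstract commutative ring, which keeps the
-- fractions of ℚ(q) from unfolding.

module IntegerSolver (R : CommutativeRing 0ℓ 0ℓ) where

  open import Algebra.Solver.Ring.AlmostCommutativeRing
    using (fromCommutativeRing; _-Raw-AlmostCommutative⟶_)
  open import Data.Integer.Base using (ℤ; -[1+_]; _⊖_)
  open import Data.Maybe.Base using (Maybe; just; nothing)
  open CommutativeRing R
  open import Algebra.Properties.Ring ring
    using (-‿+-comm; -0#≈0#; -‿involutive; -‿distribˡ-*)
  open import Algebra.Properties.Semiring.Mult.TCOptimised semiring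
    using (1+×; ×-homo-+; ×1-homo-*) renaming (_×_ to _×′_)
  open import Relation.Binary.Reasoning.Setoid setoid
  open import Algebra.Solver.CommutativeMonoid +-commutativeMonoid as +-Solver
    using (_⊕_; _⊜_)

  private
    ⟦_⟧ : ℤ → Carrier
    ⟦ + n ⟧      = n ×′ 1#
    ⟦ -[1+ n ] ⟧ = - (suc n ×′ 1#)

    ⊖-homo : ∀ m n → ⟦ m ⊖ n ⟧ ≈ m ×′ 1# - n ×′ 1#
    ⊖-homo m       zero    = sym (trans (+-congˡ -0#≈0#) (+-identityʳ _))
    ⊖-homo zero    (suc n) = sym (+-identityˡ _)
    ⊖-homo (suc m) (suc n) = begin
      ⟦ suc m ⊖ suc n ⟧                    ≡⟨ ≡.cong ⟦_⟧ (ℤₚ.[1+m]⊖[1+n]≡m⊖n m n) ⟩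
      ⟦ m ⊖ n ⟧                            ≈⟨ ⊖-homo m n ⟩
      m ×′ 1# - n ×′ 1#                      ≈⟨ +-identityˡ _ ⟨
      0# + (m ×′ 1# - n ×′ 1#)               ≈⟨ +-congʳ (-‿inverseʳ 1#) ⟨
      (1# - 1#) + (m ×′ 1# - n ×′ 1#)        ≈⟨ +-Solver.solve 4 (λ a b c d → (a ⊕ b) ⊕ (c ⊕ d) ⊜ (a ⊕ c) ⊕ (b ⊕ d)) refl 1# (- 1#) (m ×′ 1#) (- (n ×′ 1#)) ⟩
      (1# + m ×′ 1#) + (- 1# - n ×′ 1#)      ≈⟨ +-cong (1+× m 1#) (trans (-‿cong (1+× n 1#)) (sym (-‿+-comm _ _))) ⟨
      suc m ×′ 1# - suc n ×′ 1#              ∎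

    -‿homo : ∀ x → ⟦ ℤ.- x ⟧ ≈ - ⟦ x ⟧
    -‿homo (+ zero)   = sym -0#≈0#
    -‿homo (+ suc n)  = refl
    -‿homo (-[1+ n ]) = sym (-‿involutive _)

    +-homo : ∀ x y → ⟦ x ℤ.+ y ⟧ ≈ ⟦ x ⟧ + ⟦ y ⟧
    +-homo (+ m)      (+ n)      = ×-homo-+ 1# m n
    +-homo (+ m)      (-[1+ n ]) = ⊖-homo m (suc n)
    +-homo (-[1+ m ]) (+ n)      = trans (⊖-homo n (suc m)) (+-comm _ _)
    +-homo (-[1+ m ]) (-[1+ n ]) = begin
      - (suc (suc (m ℕ.+ n)) ×′ 1#)   ≡⟨ ≡.cong (λ k → - (suc k ×′ 1#)) (≡.sym (ℕₚ.+-suc m n)) ⟩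
      - ((suc m ℕ.+ suc n) ×′ 1#)     ≈⟨ -‿cong (×-homo-+ 1# (suc m) (suc n)) ⟩
      - (suc m ×′ 1# + suc n ×′ 1#)    ≈⟨ -‿+-comm _ _ ⟨
      - (suc m ×′ 1#) - (suc n ×′ 1#)  ∎

    pos-*-homo : ∀ m y → ⟦ + m ℤ.* y ⟧ ≈ m ×′ 1# * ⟦ y ⟧
    pos-*-homo m (+ n)      = trans (reflexive (≡.cong ⟦_⟧ (≡.sym (ℤₚ.pos-* m n)))) (×1-homo-* m n)
    pos-*-homo m (-[1+ n ]) = begin
      ⟦ + m ℤ.* -[1+ n ] ⟧           ≡⟨ ≡.cong ⟦_⟧ (≡.sym (ℤₚ.neg-distribʳ-* (+ m) (+ suc n))) ⟩
      ⟦ ℤ.- (+ m ℤ.* + suc n) ⟧      ≈⟨ -‿homo (+ m ℤ.* + suc n) ⟩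
      - ⟦ + m ℤ.* + suc n ⟧          ≈⟨ -‿cong (pos-*-homo m (+ suc n)) ⟩
      - (m ×′ 1# * suc n ×′ 1#)        ≈⟨ -‿distribʳ-* _ _ ⟩
      m ×′ 1# * - (suc n ×′ 1#)        ∎
      where
      open import Algebra.Properties.Ring ring using (-‿distribʳ-*)

    *-homo : ∀ x y → ⟦ x ℤ.* y ⟧ ≈ ⟦ x ⟧ * ⟦ y ⟧
    *-homo (+ m)      y = pos-*-homo m y
    *-homo (-[1+ m ]) y = begin
      ⟦ -[1+ m ] ℤ.* y ⟧         ≡⟨ ≡.cong ⟦_⟧ (≡.sym (ℤₚ.neg-distribˡ-* (+ suc m) y)) ⟩
      ⟦ ℤ.- (+ suc m ℤ.* y) ⟧    ≈⟨ -‿homo (+ suc m ℤ.* y) ⟩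
      - ⟦ + suc m ℤ.* y ⟧        ≈⟨ -‿cong (pos-*-homo (suc m) y) ⟩
      - (suc m ×′ 1# * ⟦ y ⟧)     ≈⟨ -‿distribˡ-* _ _ ⟩
      - (suc m ×′ 1#) * ⟦ y ⟧     ∎

    homomorphism : ℤ.+-*-rawRing -Raw-AlmostCommutative⟶ fromCommutativeRing R
    homomorphism = record
      { ⟦_⟧    = ⟦_⟧
      ; +-homo = +-homo
      ; *-homo = *-homo
      ; -‿homo = -‿homo
      ; 0-homo = refl
      ; 1-homo = refl
      }

    ≟-weak : ∀ x y → Maybe (⟦ x ⟧ ≈ ⟦ y ⟧)
    ≟-weak x y with x ℤₚ.≟ y
    ... | yes x≡y = just (reflexive (≡.cong ⟦_⟧ x≡y))
    ... | no  _   = nothing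

  open import Algebra.Solver.Ring ℤ.+-*-rawRing (fromCommutativeRing R) homomorphism ≟-weak public
    using (solve; _:=_; _:+_; _:*_; :-_; _:-_; con; Polynomial)

  :1 :0 : ∀ {n} → Polynomial n
  :1 = con (+ 1)
  :0 = con (+ 0)

-- Ring laws over a raw ring, units and inversion

RingLaws : RawRing 0ℓ 0ℓ → Set
RingLaws raw = IsCommutativeRing _≈_ _+_ _*_ -_ 0# 1#
  where
  open RawRing raw

-- The notions in the theorem are defined over raw rings. With the raw ring as a parameter and the
-- laws supplied separately, every `PowerSeries raw` or `QBessel raw` is literally an instance of
-- those definitions.
bundle : (raw : RawRing 0ℓ 0ℓ) → RingLaws raw → CommutativeRing 0ℓ 0ℓ
bundle raw laws = record { isCommutativeRing = laws }

module _ (R : CommutativeRing 0ℓ 0ℓ) where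

  open CommutativeRing R
  open RawSemiringOps (RawRing.rawSemiring (CommutativeRing.rawRing R)) using (_^_)

  Unit : Carrier → Set
  Unit x = ∃ λ y → x * y ≈ 1#

  -- Inversion is a total function, for fractions as well as for series, so a specification can only
  -- concern its values at units.
  InvertsUnits : (Carrier → Carrier) → Set
  InvertsUnits inv = ∀ x → Unit x → x * inv x ≈ 1#

  -- This makes every (q;q)_n a unit.
  UnitDifferences : Carrier → Set
  UnitDifferences q = ∀ i → Unit (1# + - (q * q ^ i))

-- Formal power series: ring laws, divisibility by powers of the variable, inversion

module PowerSeriesRing (raw : RawRing 0ℓ 0ℓ) (laws : RingLaws raw) where

  private
    R : CommutativeRing 0ℓ 0ℓ
    R = bundle raw laws
  open CommutativeRing R hiding (rawRing; isCommutativeRing)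
  open PowerSeries raw
  open SemiringSum semiring
  open IntegerSolver R
  open import Relation.Binary.Reasoning.Setoid setoid

  infix 4 _≋_
  _≋_ : Series → Series → Set
  f ≋ g = ∀ n → f n ≈ g n

  -- Coefficient n of a product sees only the coefficients up to n of its factors; this is what
  -- permits products modulo a power of the variable.
  ⊛-cong-≤ : ∀ {f f′ g g′} n → (∀ m → m ≤ n → f m ≈ f′ m) → (∀ m → m ≤ n → g m ≈ g′ m) →
             (f ⊛ g) n ≈ (f′ ⊛ g′) n
  ⊛-cong-≤ n f≈ g≈ = sum-cong-≋ {suc n} λ i →
    *-cong (f≈ (toℕ i) (toℕ≤pred[n] i)) (g≈ (n ∸ toℕ i) (ℕₚ.m∸n≤m n (toℕ i)))

  ⊛-cong : ∀ {f f′ g g′} → f ≋ f′ → g ≋ g′ → f ⊛ g ≋ f′ ⊛ g′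
  ⊛-cong f≈ g≈ n = ⊛-cong-≤ n (λ m _ → f≈ m) (λ m _ → g≈ m)

  ⊛-zero : ∀ f g → (f ⊛ g) 0 ≈ f 0 * g 0
  ⊛-zero f g = +-identityʳ _

  ⊛-zeroˡ : ∀ {f} g → (∀ n → f n ≈ 0#) → ∀ n → (f ⊛ g) n ≈ 0#
  ⊛-zeroˡ {f} g f≈0 zero = trans (⊛-zero f g) (trans (*-congʳ (f≈0 0)) (zeroˡ _))
  ⊛-zeroˡ g f≈0 (suc n) = trans
    (+-cong (trans (*-congʳ (f≈0 0)) (zeroˡ _)) (⊛-zeroˡ g (f≈0 ∘ suc) n))
    (+-identityˡ 0#)

  constant-0 : ∀ n → constant 0# n ≈ 0#
  constant-0 zero    = refl
  constant-0 (suc n) = refl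

  constant-⊛ : ∀ c f n → (constant c ⊛ f) n ≈ c * f n
  constant-⊛ c f zero    = ⊛-zero (constant c) f
  constant-⊛ c f (suc n) = trans (+-congˡ (⊛-zeroˡ f (λ _ → refl) n)) (+-identityʳ _)

  scale-⊛ : ∀ c f g n → ((λ m → c * f m) ⊛ g) n ≈ c * (f ⊛ g) n
  scale-⊛ c f g n = trans (sum-cong-≋ {suc n} (λ i → *-assoc c (f (toℕ i)) (g (n ∸ toℕ i))))
    (sym (*-distribˡ-sum {suc n} c (λ i → f (toℕ i) * g (n ∸ toℕ i))))

  ⊛-distribʳ : ∀ h f g → (λ n → f n + g n) ⊛ h ≋ (λ n → (f ⊛ h) n + (g ⊛ h) n)
  ⊛-distribʳ h f g n = trans
    (sum-cong-≋ {suc n} (λ i → distribʳ (h (n ∸ toℕ i)) (f (toℕ i)) (g (toℕ i))))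
    (∑-distrib-+ {suc n} (λ i → f (toℕ i) * h (n ∸ toℕ i)) (λ i → g (toℕ i) * h (n ∸ toℕ i)))

  -- The convolution unfolds by peeling the first coefficient off the left factor. This mirror image
  -- for the right factor turns commutativity into a plain induction.
  ⊛-sucʳ : ∀ f g n → (f ⊛ g) (suc n) ≈ f (suc n) * g 0 + (f ⊛ (g ∘ suc)) n
  ⊛-sucʳ f g zero    = solve 2 (λ x y → x :+ (y :+ :0) := y :+ (x :+ :0)) refl _ _
  ⊛-sucʳ f g (suc n) = trans (+-congˡ (⊛-sucʳ (f ∘ suc) g n))
    (solve 3 (λ x y z → x :+ (y :+ z) := y :+ (x :+ z)) refl _ _ _)

  ⊛-comm : ∀ f g → f ⊛ g ≋ g ⊛ f
  ⊛-comm f g zero    = +-congʳ (*-comm _ _)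
  ⊛-comm f g (suc n) = trans (+-cong (*-comm _ _) (⊛-comm (f ∘ suc) g n)) (sym (⊛-sucʳ g f n))

  ⊛-assoc : ∀ f g h → (f ⊛ g) ⊛ h ≋ f ⊛ (g ⊛ h)
  ⊛-assoc f g h zero = solve 3 (λ x y z → (x :* y :+ :0) :* z :+ :0 := x :* (y :* z :+ :0) :+ :0) refl _ _ _
  ⊛-assoc f g h (suc n) = begin
    (f 0 * g 0 + 0#) * h (suc n) + (((f ⊛ g) ∘ suc) ⊛ h) n
      ≈⟨ +-congˡ (⊛-distribʳ h (λ m → f 0 * g (suc m)) ((f ∘ suc) ⊛ g) n) ⟩
    (f 0 * g 0 + 0#) * h (suc n) + (((λ m → f 0 * g (suc m)) ⊛ h) n + (((f ∘ suc) ⊛ g) ⊛ h) n)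
      ≈⟨ +-congˡ (+-cong (scale-⊛ (f 0) (g ∘ suc) h n) (⊛-assoc (f ∘ suc) g h n)) ⟩
    (f 0 * g 0 + 0#) * h (suc n) + (f 0 * ((g ∘ suc) ⊛ h) n + ((f ∘ suc) ⊛ (g ⊛ h)) n)
      ≈⟨ solve 5 (λ a b c d e → (a :* b :+ :0) :* c :+ (a :* d :+ e) := a :* (b :* c :+ d) :+ e) refl _ _ _ _ _ ⟩
    f 0 * (g ⊛ h) (suc n) + ((f ∘ suc) ⊛ (g ⊛ h)) n ∎

  ⊛-identityˡ : ∀ f → constant 1# ⊛ f ≋ f
  ⊛-identityˡ f n = trans (constant-⊛ 1# f n) (*-identityˡ _)

  isCommutativeRing : RingLaws rawRing
  isCommutativeRing = record
    { isRing = record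
      { +-isAbelianGroup = record
        { isGroup = record
          { isMonoid = record
            { isSemigroup = record
              { isMagma = record
                { isEquivalence = record
                  { refl  = λ n → refl
                  ; sym   = λ f≈g n → sym (f≈g n)
                  ; trans = λ f≈g g≈h n → trans (f≈g n) (g≈h n)
                  }
                ; ∙-cong = λ f≈ g≈ n → +-cong (f≈ n) (g≈ n)
                }
              ; assoc = λ f g h n → +-assoc _ _ _
              }
            ; identity = (λ f n → trans (+-congʳ (constant-0 n)) (+-identityˡ _))
                       , (λ f n → trans (+-congˡ (constant-0 n)) (+-identityʳ _))
            }
          ; inverse = (λ f n → trans (-‿inverseˡ (f n)) (sym (constant-0 n)))
                    , (λ f n → trans (-‿inverseʳ (f n)) (sym (constant-0 n)))
          ; ⁻¹-cong = λ f≈g n → -‿cong (f≈g n)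
          }
        ; comm = λ f g n → +-comm _ _
        }
      ; *-cong = ⊛-cong
      ; *-assoc = ⊛-assoc
      ; *-identity = ⊛-identityˡ
                   , λ f n → trans (⊛-comm f (constant 1#) n) (⊛-identityˡ f n)
      ; distrib = (λ h f g n → trans (⊛-comm h (λ m → f m + g m) n)
                    (trans (⊛-distribʳ h f g n) (+-cong (⊛-comm f h n) (⊛-comm g h n))))
                , ⊛-distribʳ
      }
    ; *-comm = ⊛-comm
    }

  commutativeRing : CommutativeRing 0ℓ 0ℓ
  commutativeRing = bundle rawRing isCommutativeRing

  -- Divisibility by the t-th power of the variable; `Order (suc T)` means vanishing modulo the
  -- truncation at T.
  Order : ℕ → Series → Set
  Order t f = ∀ n → n < t → f n ≈ 0#

  Order-⊛ʳ : ∀ {t} f {g} → Order t g → Order t (f ⊛ g)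
  Order-⊛ʳ f {g} og zero    n<t = trans (⊛-zero f g) (trans (*-congˡ (og 0 n<t)) (zeroʳ _))
  Order-⊛ʳ f {g} og (suc n) n<t = trans
    (+-cong (trans (*-congˡ (og (suc n) n<t)) (zeroʳ _)) (Order-⊛ʳ (f ∘ suc) og n (ℕₚ.<⇒≤ n<t)))
    (+-identityˡ 0#)

  Order-⊛ˡ : ∀ {t f} g → Order t f → Order t (f ⊛ g)
  Order-⊛ˡ {f = f} g of n n<t = trans (⊛-comm f g n) (Order-⊛ʳ g of n n<t)

  Order-⊛ : ∀ {s t f g} → Order s f → Order t g → Order (s ℕ.+ t) (f ⊛ g)
  Order-⊛ {zero}  {f = f}     of og n       n<    = Order-⊛ʳ f og n n<
  Order-⊛ {suc s} {f = f} {g} of og zero    n<    = trans (⊛-zero f g) (trans (*-congʳ (of 0 (s≤s z≤n))) (zeroˡ _))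
  Order-⊛ {suc s} {f = f}     of og (suc n) (s≤s n<) = trans
    (+-cong (trans (*-congʳ (of 0 (s≤s z≤n))) (zeroˡ _))
            (Order-⊛ {s} (λ m m<s → of (suc m) (s≤s m<s)) og n n<))
    (+-identityˡ 0#)

  private
    module S = CommutativeRing commutativeRing
  open import Algebra.Definitions.RawSemiring (RawRing.rawSemiring rawRing) using () renaming (_^_ to _^ˢ_)

  Order-^ : ∀ {s f} n → Order s f → Order (n ℕ.* s) (f ^ˢ n)
  Order-^ zero    of n ()
  Order-^ (suc n) of = Order-⊛ of (Order-^ n of)

  private
    module SS = SemiringSum S.semiring

  sum-coeff : ∀ N (f : ℕ → Series) n → SS.sum {N} (λ k → f (toℕ k)) n ≈ sum {N} (λ k → f (toℕ k) n)
  sum-coeff zero    f n = constant-0 n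
  sum-coeff (suc N) f n = +-congˡ (sum-coeff N (f ∘ suc) n)

  module Inverse (_⁻¹ : Carrier → Carrier) (*-inverse : InvertsUnits R _⁻¹) where

    private
      module SSolver = IntegerSolver commutativeRing

    -- Since `u` has no constant term, coefficient n of the product involves `g` strictly below n.
    -- This strictness makes 1 + u g a contraction in `g`.
    ⊛-cong-above : ∀ {u g g′} n → u 0 ≈ 0# → (∀ m → m < n → g m ≈ g′ m) → (u ⊛ g) n ≈ (u ⊛ g′) n
    ⊛-cong-above {u} {g} {g′} zero u₀≈0 g≈ = begin
      (u ⊛ g) 0   ≈⟨ ⊛-zero u g ⟩
      u 0 * g 0   ≈⟨ trans (*-congʳ u₀≈0) (zeroˡ _) ⟩
      0#          ≈⟨ trans (*-congʳ u₀≈0) (zeroˡ _) ⟨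
      u 0 * g′ 0  ≈⟨ ⊛-zero u g′ ⟨
      (u ⊛ g′) 0  ∎
    ⊛-cong-above {u} {g} {g′} (suc n) u₀≈0 g≈ = +-cong
      (trans (trans (*-congʳ u₀≈0) (zeroˡ _)) (sym (trans (*-congʳ u₀≈0) (zeroˡ _))))
      (⊛-cong-≤ {u ∘ suc} n (λ _ _ → refl) (λ m m≤n → g≈ m (s≤s m≤n)))

    module Geometric (u : Series) (u₀≈0 : u 0 ≈ 0#) where

      partial : ℕ → Series
      partial N = SS.sum {N} (λ k → u ^ˢ toℕ k)

      partial-suc : ∀ N → partial (suc N) ≋ S.1# S.+ (u ⊛ partial N)
      partial-suc N = S.+-congˡ {S.1#} (S.sym (SS.*-distribˡ-sum {N} u (λ k → u ^ˢ toℕ k)))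

      -- Both partial sums arise by iterating the contraction 1 + u g, and each iteration moves
      -- their difference one coefficient up.
      partial-stable : ∀ N M n → n < N → n < M → partial N n ≈ partial M n
      partial-stable (suc N) (suc M) n (s≤s n≤N) (s≤s n≤M) = begin
        partial (suc N) n              ≈⟨ partial-suc N n ⟩
        S.1# n + (u ⊛ partial N) n     ≈⟨ +-congˡ (⊛-cong-above {u} n u₀≈0 λ m m<n → partial-stable N M m (ℕₚ.<-≤-trans m<n n≤N) (ℕₚ.<-≤-trans m<n n≤M)) ⟩
        S.1# n + (u ⊛ partial M) n     ≈⟨ partial-suc M n ⟨
        partial (suc M) n              ∎

      geometric : Series
      geometric n = sum {suc n} λ k → (u ^ˢ toℕ k) n

      geometric-partial : ∀ n → geometric n ≈ partial (suc n) n
      geometric-partial n = sym (sum-coeff (suc n) (u ^ˢ_) n)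

      geometric-step : geometric ≋ S.1# S.+ (u ⊛ geometric)
      geometric-step n = begin
        geometric n                    ≈⟨ geometric-partial n ⟩
        partial (suc n) n              ≈⟨ partial-suc n n ⟩
        S.1# n + (u ⊛ partial n) n     ≈⟨ +-congˡ (⊛-cong-above {u} n u₀≈0 λ m m<n → trans (partial-stable n (suc m) m m<n ℕₚ.≤-refl) (sym (geometric-partial m))) ⟩
        S.1# n + (u ⊛ geometric) n     ∎

    -- With u = 1 - c f and the geometric series g = 1 + u g, one finds f c g = g - (1 - c f) g = g
    -- - u g = 1.
    ⊛-inverse : ∀ f → Unit R (f 0) → f ⊛ inverse _⁻¹ f ≋ S.1#
    ⊛-inverse f f₀-unit = S.trans
      (S.*-congˡ {f} (λ n → sym (constant-⊛ c geometric n)))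
      (S.trans
        (SSolver.solve 3 (λ f c g → f SSolver.:* (c SSolver.:* g) SSolver.:= g SSolver.:- (SSolver.:1 SSolver.:- c SSolver.:* f) SSolver.:* g)
          (λ n → refl) f (constant c) geometric)
        (S.trans (S.+-congʳ {S.- (u ⊛ geometric)} geometric-step)
          (SSolver.solve 1 (λ x → (SSolver.:1 SSolver.:+ x) SSolver.:- x SSolver.:= SSolver.:1) (λ n → refl) (u ⊛ geometric))))
      where
      c : Carrier
      c = f 0 ⁻¹
      u : Series
      u = S.1# S.+ (S.- (constant c ⊛ f))
      u₀≈0 : u 0 ≈ 0#
      u₀≈0 = trans (+-congˡ (-‿cong (trans (⊛-zero (constant c) f) (trans (*-comm _ _) (*-inverse (f 0) f₀-unit)))))
                   (-‿inverseʳ 1#)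
      open Geometric u u₀≈0

    Unit-⊛ : ∀ f → Unit R (f 0) → Unit commutativeRing f
    Unit-⊛ f f₀-unit = inverse _⁻¹ f , ⊛-inverse f f₀-unit

    inverse-Unit : ∀ f → Unit commutativeRing f → f ⊛ inverse _⁻¹ f ≋ S.1#
    inverse-Unit f (g , fg≈1) = ⊛-inverse f (g 0 , trans (sym (⊛-zero f g)) (fg≈1 0))

-- The field ℚ(q) as fractions of polynomials

module RationalFunctions where

  module ℚ⟦q⟧ₚ = PowerSeriesRing ℚ.+-*-rawRing ℚₚ.+-*-isCommutativeRing

  -- Equality and operations of polynomials are those of their coefficient series, so `coeff` is a
  -- ring monomorphism by computation and the laws are pulled back along it.
  ℚ[q]-commutativeRing : CommutativeRing 0ℓ 0ℓ
  ℚ[q]-commutativeRing = record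
    { RawRing raw
    ; isCommutativeRing = RingMonomorphism.isCommutativeRing coeff-isRingMonomorphism
        (CommutativeRing.isCommutativeRing ℚ⟦q⟧ₚ.commutativeRing)
    }
    where
    raw : RawRing 0ℓ 0ℓ
    raw = record { _≈_ = _≈ₚ_ ; _+_ = _+ₚ_ ; _*_ = _*ₚ_ ; -_ = -ₚ_ ; 0# = 0ₚ ; 1# = 1ₚ }

    coeff-isRingMonomorphism : IsRingMonomorphism raw (CommutativeRing.rawRing ℚ⟦q⟧ₚ.commutativeRing) coeff
    coeff-isRingMonomorphism = record
      { isRingHomomorphism = record
        { isSemiringHomomorphism = record
          { isNearSemiringHomomorphism = record
            { +-isMonoidHomomorphism = record
              { isMagmaHomomorphism = record
                { isRelHomomorphism = record { cong = λ f≈g → f≈g }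
                ; homo = λ _ _ _ → ≡.refl
                }
              ; ε-homo = λ _ → ≡.refl
              }
            ; *-homo = λ _ _ _ → ≡.refl
            }
          ; 1#-homo = λ _ → ≡.refl
          }
        ; -‿homo = λ _ _ → ≡.refl
        }
      ; injective = λ f≈g → f≈g
      }

  -- The ring laws for fractions n / d after cross-multiplication, in an abstract ring so that
  -- nothing unfolds to coefficients.

  module FractionLaws (P : CommutativeRing 0ℓ 0ℓ) where

    open CommutativeRing P
    open IntegerSolver P
    open import Relation.Binary.Reasoning.Setoid setoid

    +-cong-frac : ∀ n₁ d₁ n₁′ d₁′ n₂ d₂ n₂′ d₂′ → n₁ * d₁′ ≈ n₁′ * d₁ → n₂ * d₂′ ≈ n₂′ * d₂ →
                  (n₁ * d₂ + n₂ * d₁) * (d₁′ * d₂′) ≈ (n₁′ * d₂′ + n₂′ * d₁′) * (d₁ * d₂)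
    +-cong-frac n₁ d₁ n₁′ d₁′ n₂ d₂ n₂′ d₂′ e₁ e₂ = begin
      (n₁ * d₂ + n₂ * d₁) * (d₁′ * d₂′)
        ≈⟨ solve 6 (λ n₁ d₁ d₁′ n₂ d₂ d₂′ → (n₁ :* d₂ :+ n₂ :* d₁) :* (d₁′ :* d₂′) := (n₁ :* d₁′) :* (d₂ :* d₂′) :+ (n₂ :* d₂′) :* (d₁ :* d₁′)) refl n₁ d₁ d₁′ n₂ d₂ d₂′ ⟩
      (n₁ * d₁′) * (d₂ * d₂′) + (n₂ * d₂′) * (d₁ * d₁′)
        ≈⟨ +-cong (*-congʳ e₁) (*-congʳ e₂) ⟩
      (n₁′ * d₁) * (d₂ * d₂′) + (n₂′ * d₂) * (d₁ * d₁′)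
        ≈⟨ solve 6 (λ n₁ d₁ d₁′ n₂ d₂ d₂′ → (n₁ :* d₁) :* (d₂ :* d₂′) :+ (n₂ :* d₂) :* (d₁ :* d₁′) := (n₁ :* d₂′ :+ n₂ :* d₁′) :* (d₁ :* d₂)) refl n₁′ d₁ d₁′ n₂′ d₂ d₂′ ⟩
      (n₁′ * d₂′ + n₂′ * d₁′) * (d₁ * d₂) ∎

    *-cong-frac : ∀ n₁ d₁ n₁′ d₁′ n₂ d₂ n₂′ d₂′ → n₁ * d₁′ ≈ n₁′ * d₁ → n₂ * d₂′ ≈ n₂′ * d₂ →
                  (n₁ * n₂) * (d₁′ * d₂′) ≈ (n₁′ * n₂′) * (d₁ * d₂)
    *-cong-frac n₁ d₁ n₁′ d₁′ n₂ d₂ n₂′ d₂′ e₁ e₂ = begin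
      (n₁ * n₂) * (d₁′ * d₂′)    ≈⟨ swap n₁ n₂ d₁′ d₂′ ⟩
      (n₁ * d₁′) * (n₂ * d₂′)    ≈⟨ *-cong e₁ e₂ ⟩
      (n₁′ * d₁) * (n₂′ * d₂)    ≈⟨ swap n₁′ d₁ n₂′ d₂ ⟩
      (n₁′ * n₂′) * (d₁ * d₂)    ∎
      where
      swap : ∀ a b c d → (a * b) * (c * d) ≈ (a * c) * (b * d)
      swap = solve 4 (λ a b c d → (a :* b) :* (c :* d) := (a :* c) :* (b :* d)) refl

    -‿cong-frac : ∀ n d n′ d′ → n * d′ ≈ n′ * d → - n * d′ ≈ - n′ * d
    -‿cong-frac n d n′ d′ e = begin
      - n * d′     ≈⟨ solve 2 (λ n d → :- n :* d := :- (n :* d)) refl n d′ ⟩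
      - (n * d′)   ≈⟨ -‿cong e ⟩
      - (n′ * d)   ≈⟨ solve 2 (λ n d → :- (n :* d) := :- n :* d) refl n′ d ⟩
      - n′ * d     ∎

    -- In a general ring, cross-multiplied equality is transitive only up to the middle denominator;
    -- that factor is cancelled afterwards in the domain ℚ[q].
    trans-frac : ∀ n₁ d₁ n₂ d₂ n₃ d₃ → n₁ * d₂ ≈ n₂ * d₁ → n₂ * d₃ ≈ n₃ * d₂ →
                 d₂ * (n₁ * d₃) ≈ d₂ * (n₃ * d₁)
    trans-frac n₁ d₁ n₂ d₂ n₃ d₃ e₁ e₂ = begin
      d₂ * (n₁ * d₃)   ≈⟨ solve 3 (λ a b c → a :* (b :* c) := b :* a :* c) refl d₂ n₁ d₃ ⟩
      n₁ * d₂ * d₃     ≈⟨ *-congʳ e₁ ⟩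
      n₂ * d₁ * d₃     ≈⟨ solve 3 (λ a b c → a :* b :* c := a :* c :* b) refl n₂ d₁ d₃ ⟩
      n₂ * d₃ * d₁     ≈⟨ *-congʳ e₂ ⟩
      n₃ * d₂ * d₁     ≈⟨ solve 3 (λ a b c → b :* a :* c := a :* (b :* c)) refl d₂ n₃ d₁ ⟩
      d₂ * (n₃ * d₁)   ∎

    +-assoc-frac : ∀ a b c d e f → ((a * d + c * b) * f + e * (b * d)) * (b * (d * f))
                                 ≈ (a * (d * f) + (c * f + e * d) * b) * (b * d * f)
    +-assoc-frac = solve 6 (λ a b c d e f → ((a :* d :+ c :* b) :* f :+ e :* (b :* d)) :* (b :* (d :* f))
                                 := (a :* (d :* f) :+ (c :* f :+ e :* d) :* b) :* (b :* d :* f)) refl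

    +-identityˡ-frac : ∀ a b → (0# * b + a * 1#) * b ≈ a * (1# * b)
    +-identityˡ-frac = solve 2 (λ a b → (:0 :* b :+ a :* :1) :* b := a :* (:1 :* b)) refl

    -‿inverseˡ-frac : ∀ a b → (- a * b + a * b) * 1# ≈ 0# * (b * b)
    -‿inverseˡ-frac = solve 2 (λ a b → (:- a :* b :+ a :* b) :* :1 := :0 :* (b :* b)) refl

    +-comm-frac : ∀ a b c d → (a * d + c * b) * (d * b) ≈ (c * b + a * d) * (b * d)
    +-comm-frac = solve 4 (λ a b c d → (a :* d :+ c :* b) :* (d :* b) := (c :* b :+ a :* d) :* (b :* d)) refl

    *-assoc-frac : ∀ a b c d e f → ((a * c) * e) * (b * (d * f)) ≈ (a * (c * e)) * (b * d * f)
    *-assoc-frac = solve 6 (λ a b c d e f → ((a :* c) :* e) :* (b :* (d :* f)) := (a :* (c :* e)) :* (b :* d :* f)) refl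

    *-identityˡ-frac : ∀ a b → (1# * a) * b ≈ a * (1# * b)
    *-identityˡ-frac = solve 2 (λ a b → (:1 :* a) :* b := a :* (:1 :* b)) refl

    *-comm-frac : ∀ a b c d → (a * c) * (d * b) ≈ (c * a) * (b * d)
    *-comm-frac = solve 4 (λ a b c d → (a :* c) :* (d :* b) := (c :* a) :* (b :* d)) refl

    distribˡ-frac : ∀ a b c d e f → (a * (c * f + e * d)) * ((b * d) * (b * f))
                                  ≈ ((a * c) * (b * f) + (a * e) * (b * d)) * (b * (d * f))
    distribˡ-frac = solve 6 (λ a b c d e f → (a :* (c :* f :+ e :* d)) :* ((b :* d) :* (b :* f))
                                  := ((a :* c) :* (b :* f) :+ (a :* e) :* (b :* d)) :* (b :* (d :* f))) refl

    *-inverse-frac : ∀ a b → (a * b) * 1# ≈ 1# * (b * a)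
    *-inverse-frac = solve 2 (λ a b → (a :* b) :* :1 := :1 :* (b :* a)) refl

    x-y≈0⇒x≈y : ∀ x y → x - y ≈ 0# → x ≈ y
    x-y≈0⇒x≈y x y e = begin
      x            ≈⟨ solve 2 (λ x y → x := x :- y :+ y) refl x y ⟩
      x - y + y    ≈⟨ +-congʳ e ⟩
      0# + y       ≈⟨ +-identityˡ y ⟩
      y            ∎

    x≈y⇒dx-y≈0 : ∀ d x y → d * x ≈ d * y → d * (x - y) ≈ 0#
    x≈y⇒dx-y≈0 d x y e = begin
      d * (x - y)      ≈⟨ solve 3 (λ d x y → d :* (x :- y) := d :* x :- d :* y) refl d x y ⟩
      d * x - d * y    ≈⟨ +-congʳ e ⟩
      d * y - d * y    ≈⟨ -‿inverseʳ (d * y) ⟩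
      0#               ∎

  private
    module P = CommutativeRing ℚ[q]-commutativeRing
    module L = FractionLaws ℚ[q]-commutativeRing

  ≈0ₚ⇒¬NonZero : ∀ f → f ≈ₚ 0ₚ → NonZeroₚ f → ∀ {A : Set} → A
  ≈0ₚ⇒¬NonZero f f≈0 (n , fn≢0) = contradiction (≡.trans (f≈0 n) (ℚ⟦q⟧ₚ.constant-0 n)) fn≢0

  -- A nonzero coefficient of f - g would make d (f - g) nonzero, as there are no zero divisors.
  -- Decidable equality in ℚ turns this contradiction into a proof that each coefficient vanishes.
  *ₚ-cancelˡ : ∀ d f g → NonZeroₚ d → d *ₚ f ≈ₚ d *ₚ g → f ≈ₚ g
  *ₚ-cancelˡ d f g d≢0 df≈dg = L.x-y≈0⇒x≈y f g f-g≈0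
    where
    h : ℚ[q]
    h = f P.- g
    f-g≈0 : h ≈ₚ 0ₚ
    f-g≈0 n with coeff h n ℚₚ.≟ 0ℚ
    ... | yes hn≡0 = ≡.trans hn≡0 (≡.sym (ℚ⟦q⟧ₚ.constant-0 n))
    ... | no  hn≢0 = ≈0ₚ⇒¬NonZero (d *ₚ h) (L.x≈y⇒dx-y≈0 d f g df≈dg)
                       (*ₚ-nonZero d h d≢0 (n , hn≢0))

  ≈ᶠ-sym : ∀ {x y} → x ≈ᶠ y → y ≈ᶠ x
  ≈ᶠ-sym {x} {y} e = P.sym {num x *ₚ den y} {num y *ₚ den x} e

  ≈ᶠ-trans : ∀ {x y z} → x ≈ᶠ y → y ≈ᶠ z → x ≈ᶠ z
  ≈ᶠ-trans {x} {y} {z} e₁ e₂ = *ₚ-cancelˡ (den y) (num x *ₚ den z) (num z *ₚ den x) (den-nonZero y)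
    (L.trans-frac (num x) (den x) (num y) (den y) (num z) (den z) e₁ e₂)

  ℚ⟨q⟩-laws : RingLaws ℚ⟨q⟩-rawRing
  ℚ⟨q⟩-laws = record
    { isRing = record
      { +-isAbelianGroup = record
        { isGroup = record
          { isMonoid = record
            { isSemigroup = record
              { isMagma = record
                { isEquivalence = record
                  { refl  = λ {x} → P.refl {num x *ₚ den x}
                  ; sym   = λ {x} {y} → ≈ᶠ-sym {x} {y}
                  ; trans = λ {x} {y} {z} → ≈ᶠ-trans {x} {y} {z}
                  }
                ; ∙-cong = λ {x} {x′} {y} {y′} → L.+-cong-frac (num x) (den x) (num x′) (den x′) (num y) (den y) (num y′) (den y′)
                }
              ; assoc = +-assoc
              }
            ; identity = +-identityˡ
                       , λ x → ≈ᶠ-trans {x Raw.+ Raw.0#} {Raw.0# Raw.+ x} {x} (+-comm x Raw.0#) (+-identityˡ x)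
            }
          ; inverse = -‿inverseˡ
                    , λ x → ≈ᶠ-trans {x Raw.+ (Raw.- x)} {(Raw.- x) Raw.+ x} {Raw.0#} (+-comm x (Raw.- x)) (-‿inverseˡ x)
          ; ⁻¹-cong = λ {x} {y} → L.-‿cong-frac (num x) (den x) (num y) (den y)
          }
        ; comm = +-comm
        }
      ; *-cong = λ {x} {x′} {y} {y′} → *-cong {x} {x′} {y} {y′}
      ; *-assoc = λ x y z → L.*-assoc-frac (num x) (den x) (num y) (den y) (num z) (den z)
      ; *-identity = *-identityˡ
                   , λ x → ≈ᶠ-trans {x Raw.* Raw.1#} {Raw.1# Raw.* x} {x} (*-comm x Raw.1#) (*-identityˡ x)
      ; distrib = distribˡ
                , λ x y z → ≈ᶠ-trans {(y Raw.+ z) Raw.* x} {x Raw.* (y Raw.+ z)} {(y Raw.* x) Raw.+ (z Raw.* x)}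
                    (*-comm (y Raw.+ z) x)
                    (≈ᶠ-trans {x Raw.* (y Raw.+ z)} {(x Raw.* y) Raw.+ (x Raw.* z)} {(y Raw.* x) Raw.+ (z Raw.* x)}
                      (distribˡ x y z)
                      (+-cong {x Raw.* y} {y Raw.* x} {x Raw.* z} {z Raw.* x} (*-comm x y) (*-comm x z)))
      }
    ; *-comm = *-comm
    }
    where
    module Raw = RawRing ℚ⟨q⟩-rawRing
    +-cong : ∀ {x x′ y y′} → x ≈ᶠ x′ → y ≈ᶠ y′ → (x Raw.+ y) ≈ᶠ (x′ Raw.+ y′)
    +-cong {x} {x′} {y} {y′} = L.+-cong-frac (num x) (den x) (num x′) (den x′) (num y) (den y) (num y′) (den y′)
    *-cong : ∀ {x x′ y y′} → x ≈ᶠ x′ → y ≈ᶠ y′ → (x Raw.* y) ≈ᶠ (x′ Raw.* y′)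
    *-cong {x} {x′} {y} {y′} = L.*-cong-frac (num x) (den x) (num x′) (den x′) (num y) (den y) (num y′) (den y′)
    +-assoc : ∀ x y z → ((x Raw.+ y) Raw.+ z) ≈ᶠ (x Raw.+ (y Raw.+ z))
    +-assoc x y z = L.+-assoc-frac (num x) (den x) (num y) (den y) (num z) (den z)
    +-comm : ∀ x y → (x Raw.+ y) ≈ᶠ (y Raw.+ x)
    +-comm x y = L.+-comm-frac (num x) (den x) (num y) (den y)
    +-identityˡ : ∀ x → (Raw.0# Raw.+ x) ≈ᶠ x
    +-identityˡ x = L.+-identityˡ-frac (num x) (den x)
    -‿inverseˡ : ∀ x → ((Raw.- x) Raw.+ x) ≈ᶠ Raw.0#
    -‿inverseˡ x = L.-‿inverseˡ-frac (num x) (den x)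
    *-comm : ∀ x y → (x Raw.* y) ≈ᶠ (y Raw.* x)
    *-comm x y = L.*-comm-frac (num x) (den x) (num y) (den y)
    *-identityˡ : ∀ x → (Raw.1# Raw.* x) ≈ᶠ x
    *-identityˡ x = L.*-identityˡ-frac (num x) (den x)
    distribˡ : ∀ x y z → (x Raw.* (y Raw.+ z)) ≈ᶠ ((x Raw.* y) Raw.+ (x Raw.* z))
    distribˡ x y z = L.distribˡ-frac (num x) (den x) (num y) (den y) (num z) (den z)

  ℚ⟨q⟩-commutativeRing : CommutativeRing 0ℓ 0ℓ
  ℚ⟨q⟩-commutativeRing = bundle ℚ⟨q⟩-rawRing ℚ⟨q⟩-laws

  private
    module F = CommutativeRing ℚ⟨q⟩-commutativeRing
    open RawSemiringOps (RawRing.rawSemiring ℚ⟨q⟩-rawRing) using (_^_)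

  NonZero⇒Unit : ∀ x → NonZeroₚ (num x) → Unit ℚ⟨q⟩-commutativeRing x
  NonZero⇒Unit x n≢0 = frac (den x) (num x) n≢0 , L.*-inverse-frac (num x) (den x)

  -- A zero numerator would turn x y = 1 into the vanishing of a product of denominators.
  Unit⇒NonZero : ∀ x → Unit ℚ⟨q⟩-commutativeRing x → NonZeroₚ (num x)
  Unit⇒NonZero x (y , xy≈1) with nonZeroₚ? (num x)
  ... | yes n≢0 = n≢0
  ... | no  n≡0 = ≈0ₚ⇒¬NonZero (1ₚ *ₚ (den x *ₚ den y))
      (P.trans {1ₚ *ₚ (den x *ₚ den y)} {(num x *ₚ num y) *ₚ 1ₚ} {0ₚ}
        (P.sym {(num x *ₚ num y) *ₚ 1ₚ} {1ₚ *ₚ (den x *ₚ den y)} xy≈1)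
        (P.trans {(num x *ₚ num y) *ₚ 1ₚ} {num x *ₚ num y} {0ₚ} (P.*-identityʳ (num x *ₚ num y))
          (P.trans {num x *ₚ num y} {0ₚ *ₚ num y} {0ₚ} (P.*-congʳ {num y} {num x} {0ₚ} num≈0) (P.zeroˡ (num y)))))
      (*ₚ-nonZero 1ₚ (den x *ₚ den y) 1ₚ-nonZero
        (*ₚ-nonZero (den x) (den y) (den-nonZero x) (den-nonZero y)))
    where
    num≈0 : num x ≈ₚ 0ₚ
    num≈0 n with coeff (num x) n ℚₚ.≟ 0ℚ
    ... | yes e = ≡.trans e (≡.sym (ℚ⟦q⟧ₚ.constant-0 n))
    ... | no ¬e = contradiction (n , ¬e) n≡0

  *-inverse : ∀ x → Unit ℚ⟨q⟩-commutativeRing x → (x F.* x ⁻¹) F.≈ F.1#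
  *-inverse x x-unit with nonZeroₚ? (num x)
  ... | yes n≢0 = L.*-inverse-frac (num x) (den x)
  ... | no  n≡0 = contradiction (Unit⇒NonZero x x-unit) n≡0

  qᶠ : ℚ⟨q⟩
  qᶠ = fromPoly qₚ

  qᶠ-unit : Unit ℚ⟨q⟩-commutativeRing qᶠ
  qᶠ-unit = NonZero⇒Unit qᶠ (1 , λ ())

  -- Powers of fractions are not reduced: the denominator of q^i is an iterated product of ones, so
  -- its constant term has to be computed.
  den-qᶠ^ : ∀ i → coeff (den (qᶠ ^ i)) 0 ≡ 1ℚ
  den-qᶠ^ zero    = ≡.refl
  den-qᶠ^ (suc i) = ≡.trans (ℚ⟦q⟧ₚ.⊛-zero (coeff 1ₚ) (coeff (den (qᶠ ^ i))))
    (≡.trans (ℚₚ.*-identityˡ _) (den-qᶠ^ i))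

  -- The numerator has constant term 1, because the numerator of q^(i+1) has constant term 0.
  1-qᶠ^-unit : ∀ i → Unit ℚ⟨q⟩-commutativeRing (F.1# F.+ F.- (qᶠ F.* qᶠ ^ i))
  1-qᶠ^-unit i = NonZero⇒Unit (F.1# F.+ F.- (qᶠ F.* qᶠ ^ i)) (0 , λ e → contradiction (≡.trans (≡.sym num₀) e) λ ())
    where
    d : ℚ[q]
    d = den (qᶠ F.* qᶠ ^ i)
    n : ℚ[q]
    n = num (qᶠ F.* qᶠ ^ i)
    d₀ : coeff d 0 ≡ 1ℚ
    d₀ = den-qᶠ^ (suc i)
    n₀ : coeff n 0 ≡ 0ℚ
    n₀ = ≡.trans (ℚ⟦q⟧ₚ.⊛-zero (coeff qₚ) (coeff (num (qᶠ ^ i)))) (ℚₚ.*-zeroˡ (coeff (num (qᶠ ^ i)) 0))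
    num₀ : coeff (1ₚ *ₚ d +ₚ (-ₚ n) *ₚ 1ₚ) 0 ≡ 1ℚ
    num₀ = ≡.cong₂ ℚ._+_
      (≡.trans (ℚ⟦q⟧ₚ.⊛-zero (coeff 1ₚ) (coeff d)) (≡.trans (ℚₚ.*-identityˡ _) d₀))
      (≡.trans (ℚ⟦q⟧ₚ.⊛-zero (coeff (-ₚ n)) (coeff 1ₚ)) (≡.trans (ℚₚ.*-identityʳ _) (≡.cong ℚ.-_ n₀)))

-- Geometry of a column of the lecture hall graph

fromℚᵘ-mono-≤ : ∀ p q → p ℚᵘ.≤ q → ℚ.fromℚᵘ p ℚ.≤ ℚ.fromℚᵘ q
fromℚᵘ-mono-≤ p q p≤q = ℚₚ.toℚᵘ-cancel-≤
  (ℚᵘₚ.≤-trans (ℚᵘₚ.≤-reflexive (ℚₚ.toℚᵘ-fromℚᵘ p))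
  (ℚᵘₚ.≤-trans p≤q (ℚᵘₚ.≤-reflexive (ℚᵘₚ.≃-sym (ℚₚ.toℚᵘ-fromℚᵘ q)))))

height-≥ : ∀ {T} v → T ≤ Vertex.t v → (+ T ℚ./ 1) ℚ.≤ height v
height-≥ {T} ⟨ t , i , j ⟩ T≤t = ℚₚ.≤-trans
  (ℚₚ.≤-reflexive (≡.sym (ℚₚ.+-identityʳ (+ T ℚ./ 1))))
  (ℚₚ.+-mono-≤
    (fromℚᵘ-mono-≤ (mkℚᵘ (+ T) 0) (mkℚᵘ (+ t) 0) (*≤* (ℤₚ.*-monoʳ-≤-nonNeg (+ 1) (ℤ.+≤+ T≤t))))
    (ℚₚ.nonNegative⁻¹ (ℚ.normalize j (suc i)) {{ℚₚ.normalize-nonNeg j (suc i)}}))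

north : Vertex → Vertex
north ⟨ t , i , j ⟩ with j ℕₚ.<? i
... | yes j<i = ⟨ t , i , suc j ⟩ {j<i}
... | no  _   = ⟨ suc t , i , 0 ⟩ {z≤n}

step-north : ∀ v → Step (north v) v
step-north (⟨ t , i , j ⟩ {j≤i}) with j ℕₚ.<? i
... | yes j<i = south
... | no  j≮i with ℕₚ.≤-antisym (recompute (j ℕₚ.≤? i) j≤i) (ℕₚ.≮⇒≥ j≮i)
...   | ≡.refl = south₀

column-north : ∀ v → column (north v) ≡ column v
column-north ⟨ t , i , j ⟩ with j ℕₚ.<? i
... | yes _ = ≡.refl
... | no  _ = ≡.refl

-- The number of vertices below `v` in its column. It grows by one along `north`, so it converts a
-- number of steps into a level.
depth : Vertex → ℕ
depth ⟨ t , i , j ⟩ = t ℕ.* suc i ℕ.+ j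

depth-north : ∀ v → depth (north v) ≡ suc (depth v)
depth-north (⟨ t , i , j ⟩ {j≤i}) with j ℕₚ.<? i
... | yes _   = ℕₚ.+-suc (t ℕ.* suc i) j
... | no  j≮i with ℕₚ.≤-antisym (recompute (j ℕₚ.≤? i) j≤i) (ℕₚ.≮⇒≥ j≮i)
...   | ≡.refl = ≡.trans (ℕₚ.+-identityʳ _) (≡.cong suc (ℕₚ.+-comm i (t ℕ.* suc i)))

depth-≥ : ∀ {T} v → T ℕ.* suc (column v) ≤ depth v → T ≤ Vertex.t v
depth-≥ {T} (⟨ t , i , j ⟩ {j≤i}) le = ℕₚ.≮⇒≥ λ t<T → ℕₚ.<-irrefl ≡.refl (begin-strict
  t ℕ.* suc i ℕ.+ j       <⟨ ℕₚ.+-monoʳ-< (t ℕ.* suc i) (s≤s (recompute (j ℕₚ.≤? i) j≤i)) ⟩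
  t ℕ.* suc i ℕ.+ suc i   ≡⟨ ℕₚ.+-comm (t ℕ.* suc i) (suc i) ⟩
  suc t ℕ.* suc i         ≤⟨ ℕₚ.*-monoˡ-≤ (suc i) t<T ⟩
  T ℕ.* suc i             ≤⟨ le ⟩
  t ℕ.* suc i ℕ.+ j       ∎)
  where
  open ℕₚ.≤-Reasoning

column-step : ∀ {u v} → Step u v → column u ≤ column v
column-step east   = ℕₚ.n≤1+n _
column-step south  = ℕₚ.≤-refl
column-step south₀ = ℕₚ.≤-refl

step-in-column : ∀ {u v} → Step u v → column u ≡ column v → u ≡ north v
step-in-column east e = contradiction (≡.sym e) ℕₚ.1+n≢n
step-in-column (south {t} {i} {j} {p}) e with j ℕₚ.<? i
... | yes _   = ≡.refl
... | no  j≮i = ⊥-elim-irr (j≮i p)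
step-in-column (south₀ {t} {i}) e with i ℕₚ.<? i
... | yes i<i = contradiction i<i (ℕₚ.n≮n i)
... | no  _   = ≡.refl

infixr 5 _◂_
_◂_ : ∀ {A : Set} → A → (ℕ → A) → ℕ → A
(x ◂ f) zero    = x
(x ◂ f) (suc n) = f n

-- Paths from (k,∞) to an arbitrary vertex

module Paths (k : ℕ) where

  -- This is `SE` with a free end vertex, as a recursion on the last step demands.
  record Path (v : Vertex) : Set where
    constructor path
    field
      vertex : ℕ → Vertex
      end    : vertex 0 ≡ v
      step   : ∀ m → Step (vertex (suc m)) (vertex m)
      limit  : ∀ (T : ℕ) → ∃[ M ] ∀ m → M ≤ m →
               column (vertex m) ≡ k × (+ T ℚ./ 1) ℚ.≤ height (vertex m)

  Path-setoid : Vertex → Setoid 0ℓ 0ℓ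
  Path-setoid v = On.setoid (ℕ →-setoid Vertex) (Path.vertex {v})

  length : ∀ {v} → Path v → ℕ
  length p = proj₁ (Path.limit p 0)

  -- All bounds in `limit` grow by one, so the weight of the new path counts the new step.
  cons : ∀ {u v} → Step u v → Path u → Path v
  cons {v = v} s (path f ≡.refl st lim) = path (v ◂ f) ≡.refl
    (λ { zero → s ; (suc m) → st m })
    (λ T → suc (proj₁ (lim T)) , λ { (suc m) (s≤s M≤m) → proj₂ (lim T) m M≤m })

  -- `cons` matches on the end equation and is stuck at a variable path; this equation and the next
  -- stand in for its unfolding.
  cons-zero : ∀ {u v} (s : Step u v) p → Path.vertex (cons s p) 0 ≡ v
  cons-zero s (path f ≡.refl st lim) = ≡.refl

  cons-suc : ∀ {u v} (s : Step u v) p m → Path.vertex (cons s p) (suc m) ≡ Path.vertex p m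
  cons-suc s (path f ≡.refl st lim) m = ≡.refl

  cons-cong : ∀ {u v} (s : Step u v) {p r} → (∀ m → Path.vertex p m ≡ Path.vertex r m) →
              ∀ m → Path.vertex (cons s p) m ≡ Path.vertex (cons s r) m
  cons-cong s {p} {r} p≈r zero    = ≡.trans (cons-zero s p) (≡.sym (cons-zero s r))
  cons-cong s {p} {r} p≈r (suc m) = ≡.trans (cons-suc s p m) (≡.trans (p≈r m) (≡.sym (cons-suc s r m)))

  cons-injective : ∀ {u v} (s : Step u v) {p r} →
                   (∀ m → Path.vertex (cons s p) m ≡ Path.vertex (cons s r) m) →
                   ∀ m → Path.vertex p m ≡ Path.vertex r m
  cons-injective s {p} {r} e m = ≡.trans (≡.sym (cons-suc s p m)) (≡.trans (e (suc m)) (cons-suc s r m))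

  rest : ∀ v → column v ≡ k → Path v
  rest v col = path f ≡.refl (λ m → step-north (f m))
    -- A level of column k has k+1 vertices, so T (k+1) steps up reach level T from anywhere. At T =
    -- 0 the bound is 0, which makes the weight of this path the empty product.
    (λ T → T ℕ.* suc k , λ m M≤m → col-f m , height-≥ {T} (f m) (depth-≥ {T} (f m)
      (ℕₚ.≤-trans (ℕₚ.≤-reflexive (≡.cong (λ i → T ℕ.* suc i) (col-f m))) (ℕₚ.≤-trans M≤m (depth-f m)))))
    where
    f : ℕ → Vertex
    f zero    = v
    f (suc m) = north (f m)
    col-f : ∀ m → column (f m) ≡ k
    col-f zero    = col
    col-f (suc m) = ≡.trans (column-north (f m)) (col-f m)
    depth-f : ∀ m → m ≤ depth (f m)
    depth-f zero    = z≤n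
    depth-f (suc m) = ℕₚ.≤-trans (s≤s (depth-f m)) (ℕₚ.≤-reflexive (≡.sym (depth-north (f m))))

  column-antitone : ∀ {v} (p : Path v) m l → column (Path.vertex p (m ℕ.+ l)) ≤ column (Path.vertex p l)
  column-antitone p zero    l = ℕₚ.≤-refl
  column-antitone p (suc m) l = ℕₚ.≤-trans (column-step (Path.step p (m ℕ.+ l))) (column-antitone p m l)

  -- Going back along a path the column never increases, and it is eventually k; a path ending in
  -- column k is squeezed between the two.
  column-rest : ∀ {v} (p : Path v) → column v ≡ k → ∀ m → column (Path.vertex p m) ≡ k
  column-rest p@(path f ≡.refl st lim) col m = ℕₚ.≤-antisym
    (ℕₚ.≤-trans (ℕₚ.≤-trans (ℕₚ.≤-reflexive (≡.cong (column ∘ f) (≡.sym (ℕₚ.+-identityʳ m)))) (column-antitone p m 0)) (ℕₚ.≤-reflexive col))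
    (ℕₚ.≤-trans (ℕₚ.≤-reflexive (≡.sym (proj₁ (proj₂ (lim 0) (length p ℕ.+ m) (ℕₚ.m≤m+n _ m)))))
      (column-antitone p (length p) m))

  rest-unique : ∀ {v} (p r : Path v) → column v ≡ k → ∀ m → Path.vertex p m ≡ Path.vertex r m
  rest-unique p r col zero    = ≡.trans (Path.end p) (≡.sym (Path.end r))
  rest-unique p r col (suc m) = ≡.trans (next p) (≡.trans (≡.cong north (rest-unique p r col m)) (≡.sym (next r)))
    where
    next : ∀ p → Path.vertex p (suc m) ≡ north (Path.vertex p m)
    next p = step-in-column (Path.step p m)
      (≡.trans (column-rest p col (suc m)) (≡.sym (column-rest p col m)))

-- Sums of path weights modulo powers of the variable

module PathSums (raw : RawRing 0ℓ 0ℓ) (laws : RingLaws raw) (k : ℕ) where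

  open CommutativeRing (bundle raw laws) hiding (zero; rawRing; isCommutativeRing)
  open PowerSeries raw using (Series; _⊛_; rawRing)
  open PowerSeriesRing raw laws
  open Weights rawRing
  open Paths k
  private
    module S = CommutativeRing commutativeRing
  open RawSemiringOps (RawRing.rawSemiring rawRing) using (product)
  open import Relation.Binary.Reasoning.Setoid setoid

  module _ (w : WeightSystem) (w-order : ∀ v → Order (Vertex.t v) (w v)) where

    weight : ∀ {v} → Path v → Series
    weight p = product {length p} λ m → stepWeight w (Path.step p (toℕ m))

    weight-cons : ∀ {u v} (s : Step u v) (p : Path u) → weight (cons s p) S.≈ stepWeight w s S.* weight p
    weight-cons s (path f ≡.refl st lim) = S.refl

    product-pred : ∀ M (g : ℕ → Series) → M ≢ 0 →
                   product {M} (g ∘ toℕ) S.≈ g 0 S.* product {ℕ.pred M} (g ∘ suc ∘ toℕ)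
    product-pred zero    g M≢0 = contradiction ≡.refl M≢0
    product-pred (suc M) g M≢0 = S.refl

    record Uncons {v} (p : Path v) : Set where
      constructor uncons-as
      field
        {source} : Vertex
        first    : Step source v
        others   : Path source
        vertices : ∀ m → Path.vertex p m ≡ Path.vertex (cons first others) m
        weights  : weight p S.≈ stepWeight w first S.* weight others
        lengths  : length p ≡ suc (length others)

    -- Outside column k the bound in `limit` is positive, so the last step is a factor of the
    -- weight. Lowering all bounds by one leaves exactly the weight of the remaining path.
    uncons : ∀ {v} → column v ≢ k → (p : Path v) → Uncons p
    uncons col≢k p@(path f ≡.refl st lim) = uncons-as (st 0) others vertices
      (product-pred (length p) (λ m → stepWeight w (st m)) length≢0)
      (≡.sym (ℕₚ.suc-pred (length p) {{ℕ.≢-nonZero length≢0}}))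
      where
      length≢0 : length p ≢ 0
      length≢0 e = col≢k (proj₁ (proj₂ (lim 0) 0 (ℕₚ.≤-reflexive e)))
      ≤-suc-pred : ∀ n → n ≤ suc (ℕ.pred n)
      ≤-suc-pred zero    = z≤n
      ≤-suc-pred (suc n) = ℕₚ.≤-refl
      others : Path (f 1)
      others = path (f ∘ suc) ≡.refl (st ∘ suc)
        (λ T → ℕ.pred (proj₁ (lim T)) , λ m M≤m → proj₂ (lim T) (suc m) (ℕₚ.≤-trans (≤-suc-pred (proj₁ (lim T))) (s≤s M≤m)))
      vertices : ∀ m → f m ≡ Path.vertex (cons (st 0) others) m
      vertices zero    = ≡.refl
      vertices (suc m) = ≡.refl

    -- Off column k a path must contain an east step. Going back from `v`, the first one met lies at
    -- the level of `v` or higher, and its weight alone carries the required power. The recursion is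
    -- on the bound, which cannot be 0 before such a step is met.
    weight-high : ∀ {T v} M (p : Path v) → length p ≡ M → column v ≢ k → T < Vertex.t v → Order (suc T) (weight p)
    weight-high {T} M p len col≢k T<t with uncons col≢k p
    weight-high zero p len col≢k T<t | uncons-as s r _ _ len′ = contradiction (≡.trans (≡.sym len′) len) ℕₚ.1+n≢0
    weight-high (suc M) p len col≢k T<t | uncons-as {u} s r _ p≈ len′ = λ n n<T → trans (p≈ n) (order s n n<T)
      where
      len-r : length r ≡ M
      len-r = ℕₚ.suc-injective (≡.trans (≡.sym len′) len)
      order : (s : Step u _) → Order (suc _) (stepWeight w s ⊛ weight r)
      order east   = Order-⊛ˡ (weight r) (λ n n<T → w-order u n (ℕₚ.<-≤-trans n<T T<t))
      order south  = Order-⊛ʳ S.1# (weight-high M r len-r col≢k T<t)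
      order south₀ = Order-⊛ʳ S.1# (weight-high M r len-r col≢k (ℕₚ.m≤n⇒m≤1+n T<t))

    module Truncated (T : ℕ) where

      total : ∀ {v} → List (Path v) → Series
      total ps m = foldr _+_ 0# (map (λ p → weight p m) ps)

      -- Modulo X^{T+1}, the weights of the paths to v have the sum s.
      record SumsTo (v : Vertex) (s : Series) : Set where
        open Membership (Path-setoid v) using (_∉_)
        open Unique (Path-setoid v) using (Unique)
        field
          paths    : List (Path v)
          unique   : Unique paths
          complete : ∀ p → p ∉ paths → Order (suc T) (weight p)
          sum      : ∀ m → m ≤ T → s m ≈ total paths m

      open SumsTo

      SumsTo-resp : ∀ {v s s′} → (∀ m → s′ m ≈ s m) → SumsTo v s → SumsTo v s′
      SumsTo-resp s′≈s Σs = record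
        { paths = paths Σs ; unique = unique Σs ; complete = complete Σs
        ; sum = λ m m≤T → trans (s′≈s m) (sum Σs m m≤T) }

      sum-rest : ∀ v → column v ≡ k → SumsTo v S.1#
      sum-rest v col = record
        { paths    = rest v col ∷ []
        ; unique   = [] ∷ []
        ; complete = λ p p∉ → contradiction (here (rest-unique p (rest v col) col)) p∉
        ; sum      = λ m _ → sym (+-identityʳ _)
        }

      sum-high : ∀ v {s} → column v ≢ k → T < Vertex.t v → Order (suc T) s → SumsTo v s
      sum-high v col≢k T<t s-order = record
        { paths    = []
        ; unique   = []
        ; complete = λ p _ → weight-high (length p) p ≡.refl col≢k T<t
        ; sum      = λ m m≤T → s-order m (s≤s m≤T)
        }

      total-cons : ∀ {u v} (s : Step u v) ps m → total (map (cons s) ps) m ≈ (stepWeight w s ⊛ total ps) m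
      total-cons {u} s []       m = sym (trans (⊛-comm (stepWeight w s) (total {u} []) m) (⊛-zeroˡ {total {u} []} (stepWeight w s) (λ _ → refl) m))
      total-cons s (p ∷ ps) m = begin
        weight (cons s p) m + total (map (cons s) ps) m                          ≈⟨ +-cong (weight-cons s p m) (total-cons s ps m) ⟩
        (stepWeight w s ⊛ weight p) m + (stepWeight w s ⊛ total ps) m            ≈⟨ S.distribˡ (stepWeight w s) (weight p) (total ps) m ⟨
        (stepWeight w s ⊛ total (p ∷ ps)) m                                      ∎

      total-++ : ∀ {v} (ps qs : List (Path v)) m → total (ps ++ qs) m ≈ total ps m + total qs m
      total-++ []       qs m = sym (+-identityˡ _)
      total-++ (p ∷ ps) qs m = trans (+-congˡ (total-++ ps qs m)) (sym (+-assoc _ _ _))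

      complete-cons : ∀ {u v s} (e : Step u v) (Σs : SumsTo u s) (p : Path v) (r : Path u) →
                      weight p S.≈ stepWeight w e S.* weight r → Membership._∉_ (Path-setoid u) r (paths Σs) →
                      Order (suc T) (weight p)
      complete-cons e Σs p r p≈ r∉ n n<T = trans (p≈ n) (Order-⊛ʳ (stepWeight w e) (complete Σs r r∉) n n<T)

      sum-cons : ∀ {u v s} (e : Step u v) (Σs : SumsTo u s) m → m ≤ T →
                 (stepWeight w e ⊛ s) m ≈ total (map (cons e) (paths Σs)) m
      sum-cons e Σs m m≤T = trans
        (⊛-cong-≤ {stepWeight w e} m (λ _ _ → refl) (λ l l≤m → sum Σs l (ℕₚ.≤-trans l≤m m≤T)))
        (sym (total-cons e (paths Σs) m))

      unique-cons : ∀ {u v s} (e : Step u v) (Σs : SumsTo u s) → Unique.Unique (Path-setoid v) (map (cons e) (paths Σs))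
      unique-cons {u} {v} e Σs = Uniqueₚ.map⁺ (Path-setoid u) (Path-setoid v) (λ {p} {r} → cons-injective e {p} {r}) (unique Σs)

      cons-∈ : ∀ {u v} (e : Step u v) (p : Path v) (r : Path u) ps → (∀ m → Path.vertex p m ≡ Path.vertex (cons e r) m) →
               Membership._∈_ (Path-setoid u) r ps → Membership._∈_ (Path-setoid v) p (map (cons e) ps)
      cons-∈ {u} {v} e p r ps p≈ r∈ = Membershipₚ.∈-resp-≈ (Path-setoid v) {map (cons e) ps} {cons e r} {p} (λ m → ≡.sym (p≈ m))
        (Membershipₚ.∈-map⁺ (Path-setoid u) (Path-setoid v) (λ {p} {r} → cons-cong e {p} {r}) {r} {ps} r∈)

      sum-one-step : ∀ {u v s} (e : Step u v) →
        ((f : ∃ λ u′ → Step u′ v) → f ≡ (u , e)) → column v ≢ k →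
        SumsTo u s → SumsTo v (stepWeight w e S.* s)
      sum-one-step {u} {v} {s} e only col≢k Σs = record
        { paths    = map (cons e) (paths Σs)
        ; unique   = unique-cons e Σs
        ; complete = λ p p∉ → complete′ p p∉ (uncons col≢k p)
        ; sum      = sum-cons e Σs
        }
        where
        complete′ : ∀ p → Membership._∉_ (Path-setoid v) p (map (cons e) (paths Σs)) → Uncons p → Order (suc T) (weight p)
        complete′ p p∉ (uncons-as f r p≈ w≈ _) with ≡.refl ← only (_ , f) =
          complete-cons e Σs p r w≈ (p∉ ∘ cons-∈ e p r (paths Σs) p≈)

      -- The two lists are disjoint because equal paths agree in the vertex before the end, and that
      -- vertex is the source of the last step.
      sum-two-steps : ∀ {u₁ u₂ v s₁ s₂} (e₁ : Step u₁ v) (e₂ : Step u₂ v) → u₁ ≢ u₂ →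
        ((f : ∃ λ u′ → Step u′ v) → f ≡ (u₁ , e₁) ⊎ f ≡ (u₂ , e₂)) → column v ≢ k →
        SumsTo u₁ s₁ → SumsTo u₂ s₂ → SumsTo v ((stepWeight w e₁ S.* s₁) S.+ (stepWeight w e₂ S.* s₂))
      sum-two-steps {u₁} {u₂} {v} {s₁} {s₂} e₁ e₂ u₁≢u₂ only col≢k Σs₁ Σs₂ = record
        { paths    = ps₁ ++ ps₂
        ; unique   = Uniqueₚ.++⁺ (Path-setoid v) (unique-cons e₁ Σs₁) (unique-cons e₂ Σs₂) (λ {p} → disjoint {p})
        ; complete = λ p p∉ → complete′ p p∉ (uncons col≢k p)
        ; sum      = λ m m≤T → trans (+-cong (sum-cons e₁ Σs₁ m m≤T) (sum-cons e₂ Σs₂ m m≤T)) (sym (total-++ ps₁ ps₂ m))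
        }
        where
        ps₁ ps₂ : List (Path v)
        ps₁ = map (cons e₁) (paths Σs₁)
        ps₂ = map (cons e₂) (paths Σs₂)
        disjoint : ∀ {p} → ¬ (Membership._∈_ (Path-setoid v) p ps₁ × Membership._∈_ (Path-setoid v) p ps₂)
        disjoint {p} (∈₁ , ∈₂) with Membershipₚ.∈-map⁻ (Path-setoid u₁) (Path-setoid v) {p} ∈₁
                                  | Membershipₚ.∈-map⁻ (Path-setoid u₂) (Path-setoid v) {p} ∈₂
        ... | r₁ , _ , p≈₁ | r₂ , _ , p≈₂ = u₁≢u₂ (≡.trans (second e₁ r₁ p≈₁) (≡.sym (second e₂ r₂ p≈₂)))
          where
          second : ∀ {u} (e : Step u v) r → (∀ m → Path.vertex p m ≡ Path.vertex (cons e r) m) → u ≡ Path.vertex p 1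
          second e r p≈ = ≡.sym (≡.trans (p≈ 1) (≡.trans (cons-suc e r 0) (Path.end r)))
        complete′ : ∀ p → Membership._∉_ (Path-setoid v) p (ps₁ ++ ps₂) → Uncons p → Order (suc T) (weight p)
        complete′ p p∉ (uncons-as f r p≈ w≈ _) with only (_ , f)
        ... | inj₁ ≡.refl = complete-cons e₁ Σs₁ p r w≈
                (p∉ ∘ Membershipₚ.∈-++⁺ˡ (Path-setoid v) {p} {ps₁} {ps₂} ∘ cons-∈ e₁ p r (paths Σs₁) p≈)
        ... | inj₂ ≡.refl = complete-cons e₂ Σs₂ p r w≈
                (p∉ ∘ Membershipₚ.∈-++⁺ʳ (Path-setoid v) {p} ps₁ {ps₂} ∘ cons-∈ e₂ p r (paths Σs₂) p≈)

    -- The hypotheses express the splitting of the paths to ⟨ t , i , j ⟩ by their last step.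
    module _ (s : ℕ → ℕ → ℕ → Series)
             (s-rest  : ∀ t j → s t k j S.≈ S.1#)
             (s-steps : ∀ t d j .(j≤i : j ≤ d ℕ.+ k) → s t (suc d ℕ.+ k) j S.≈
                          s t (suc d ℕ.+ k) (suc j) S.+ (w (⟨ t , d ℕ.+ k , j ⟩ {j≤i}) S.* s t (d ℕ.+ k) j))
             (s-wrap  : ∀ t d → s t (suc d ℕ.+ k) (suc d ℕ.+ k) S.≈ s (suc t) (suc d ℕ.+ k) 0)
             (s-order : ∀ t d j → Order t (s t (suc d ℕ.+ k) j))
             where

      module _ (T : ℕ) where
        open Truncated T

        column≢ : ∀ d → suc d ℕ.+ k ≢ k
        column≢ d e = ℕₚ.<-irrefl (≡.sym e) (s≤s (ℕₚ.m≤n+m k d))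

        -- Three nested inductions: on the column; on a counter `e` with T < e + t, which reaches 0
        -- only at levels above T, where the empty list suffices; and on the distance i - j to the
        -- top of the level, where the path wraps to the next level.
        sum-at : ∀ d t j .(j≤i : j ≤ d ℕ.+ k) → SumsTo (⟨ t , d ℕ.+ k , j ⟩ {j≤i}) (s t (d ℕ.+ k) j)
        sum-at zero    t j j≤i = SumsTo-resp (s-rest t j) (sum-rest ⟨ t , k , j ⟩ ≡.refl)
        sum-at (suc d) t j j≤i = row (suc T) t (s≤s (ℕₚ.m≤m+n T t)) j j≤i
          where
          i : ℕ
          i = suc d ℕ.+ k
          row : ∀ e t → T < e ℕ.+ t → ∀ j .(j≤i : j ≤ i) → SumsTo (⟨ t , i , j ⟩ {j≤i}) (s t i j)
          row zero    t T<t j j≤i = sum-high ⟨ t , i , j ⟩ (column≢ d) T<t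
            (λ n n≤T → s-order t d j n (ℕₚ.<-≤-trans n≤T T<t))
          row (suc e) t T<e+t j j≤i = cell (i ∸ j) j (ℕₚ.m∸n+n≡m (recompute (j ℕₚ.≤? i) j≤i)) j≤i
            where
            cell : ∀ c j → c ℕ.+ j ≡ i → .(j≤i : j ≤ i) → SumsTo (⟨ t , i , j ⟩ {j≤i}) (s t i j)
            cell zero j ≡.refl j≤i = SumsTo-resp
              (S.trans (s-wrap t d) (S.sym (S.*-identityˡ (s (suc t) i 0))))
              (sum-one-step (south₀ {t} {i} {z≤n}) only (column≢ d)
                (row e (suc t) (ℕₚ.<-≤-trans T<e+t (ℕₚ.≤-reflexive (≡.sym (ℕₚ.+-suc e t)))) 0 z≤n))
              where
              only : (f : ∃ λ u → Step u ⟨ t , i , i ⟩) → f ≡ (⟨ suc t , i , 0 ⟩ , south₀)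
              only (_ , east {p = p})  = ⊥-elim-irr (ℕₚ.1+n≰n p)
              only (_ , south {p = p}) = ⊥-elim-irr (ℕₚ.1+n≰n p)
              only (_ , south₀)        = ≡.refl
            cell (suc c) j c+j≡i j≤i = SumsTo-resp
              (S.trans (s-steps t d j j≤i-1) (S.+-congʳ {w ⟨ t , d ℕ.+ k , j ⟩ S.* s t (d ℕ.+ k) j} (S.sym (S.*-identityˡ (s t i (suc j))))))
              (sum-two-steps (south {p = j<i}) (east {p = j≤i-1}) (λ e → ℕₚ.1+n≢n (≡.cong column e)) only (column≢ d)
                (cell c (suc j) (≡.trans (ℕₚ.+-suc c j) c+j≡i) j<i)
                (sum-at d t j j≤i-1))
              where
              j<i : j < i
              j<i = ℕₚ.≤-trans (s≤s (ℕₚ.m≤n+m j c)) (ℕₚ.≤-reflexive c+j≡i)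
              j≤i-1 : j ≤ d ℕ.+ k
              j≤i-1 = ℕₚ.≤-pred j<i
              only : (f : ∃ λ u → Step u ⟨ t , i , j ⟩) →
                     f ≡ (⟨ t , i , suc j ⟩ , south {p = j<i}) ⊎ f ≡ (⟨ t , d ℕ.+ k , j ⟩ , east {p = j≤i-1})
              only (_ , east)   = inj₂ ≡.refl
              only (_ , south)  = inj₁ ≡.refl
              only (_ , south₀) = contradiction j<i (ℕₚ.n≮n i)

      open Summation raw using (HasSum)

      hasSum : ∀ n → k ≤ n → HasSum (SE-setoid k n) (pathWeight w) (s 0 n 0)
      hasSum n k≤n m = map toSE paths
        , Uniqueₚ.map⁺ (Path-setoid v₀) (SE-setoid k n) (λ e → e) unique
        , (λ p p∉ → complete (fromSE p) (p∉ ∘ ∈-toSE p) m ℕₚ.≤-refl)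
        , trans (sum m ℕₚ.≤-refl) (reflexive (≡.cong (foldr _+_ 0#) (map-∘ paths)))
        where
        v₀ : Vertex
        v₀ = ⟨ 0 , n , 0 ⟩ {z≤n}
        toSE : Path v₀ → SE k n
        toSE (path f e st lim) = record { vertex = f ; end = e ; step = st ; limit = lim }
        fromSE : SE k n → Path v₀
        fromSE p = path (SE.vertex p) (SE.end p) (SE.step p) (SE.limit p)
        -- Coefficient m is read off the truncation at m, so the list of paths depends on m.
        open Truncated m
        sums : SumsTo v₀ (s 0 n 0)
        sums = ≡.subst (λ i → SumsTo (⟨ 0 , i , 0 ⟩ {z≤n}) (s 0 i 0)) (ℕₚ.m∸n+n≡m k≤n) (sum-at m (n ∸ k) 0 0 z≤n)
        open SumsTo sums
        ∈-toSE : ∀ p → Membership._∈_ (Path-setoid v₀) (fromSE p) paths → Membership._∈_ (SE-setoid k n) p (map toSE paths)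
        ∈-toSE p = Membershipₚ.∈-map⁺ (Path-setoid v₀) (SE-setoid k n) (λ e → e) {fromSE p} {paths}

-- Units and finite sums in a commutative ring

module Units (A : CommutativeRing 0ℓ 0ℓ) where

  open CommutativeRing A hiding (zero)
  open IntegerSolver A
  open import Relation.Binary.Reasoning.Setoid setoid

  1-unit : Unit A 1#
  1-unit = 1# , *-identityˡ 1#

  *-unit : ∀ {x y} → Unit A x → Unit A y → Unit A (x * y)
  *-unit {x} {y} (x′ , xx′≈1) (y′ , yy′≈1) = x′ * y′ , (begin
    x * y * (x′ * y′)      ≈⟨ solve 4 (λ x y x′ y′ → x :* y :* (x′ :* y′) := (x :* x′) :* (y :* y′)) refl x y x′ y′ ⟩
    (x * x′) * (y * y′)    ≈⟨ *-cong xx′≈1 yy′≈1 ⟩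
    1# * 1#                ≈⟨ *-identityˡ 1# ⟩
    1#                     ∎)

  unit-resp : ∀ {x y} → x ≈ y → Unit A x → Unit A y
  unit-resp x≈y (x′ , xx′≈1) = x′ , trans (*-congʳ (sym x≈y)) xx′≈1

  unit-cancelˡ : ∀ {x} → Unit A x → ∀ y z → x * y ≈ x * z → y ≈ z
  unit-cancelˡ {x} (x′ , xx′≈1) y z xy≈xz = begin
    y              ≈⟨ *-identityˡ y ⟨
    1# * y         ≈⟨ *-congʳ xx′≈1 ⟨
    x * x′ * y     ≈⟨ solve 3 (λ x x′ y → x :* x′ :* y := x′ :* (x :* y)) refl x x′ y ⟩
    x′ * (x * y)   ≈⟨ *-congˡ xy≈xz ⟩
    x′ * (x * z)   ≈⟨ solve 3 (λ x x′ y → x′ :* (x :* y) := x :* x′ :* y) refl x x′ z ⟩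
    x * x′ * z     ≈⟨ *-congʳ xx′≈1 ⟩
    1# * z         ≈⟨ *-identityˡ z ⟩
    z              ∎

module Sums (raw : RawRing 0ℓ 0ℓ) (laws : RingLaws raw) where

  open CommutativeRing (bundle raw laws) hiding (zero; rawRing)
  open SemiringSum semiring public using (sum; ∑-comm; ∑-distrib-+; *-distribˡ-sum; *-distribʳ-sum)
  open import Relation.Binary.Reasoning.Setoid setoid

  ∑ : ℕ → (ℕ → Carrier) → Carrier
  ∑ n f = sum {n} (λ i → f (toℕ i))

  ∑-cong : ∀ n {f g} → (∀ i → i < n → f i ≈ g i) → ∑ n f ≈ ∑ n g
  ∑-cong zero    f≈g = refl
  ∑-cong (suc n) f≈g = +-cong (f≈g 0 (s≤s z≤n)) (∑-cong n λ i i<n → f≈g (suc i) (s≤s i<n))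

  ∑-zero : ∀ n {f} → (∀ i → i < n → f i ≈ 0#) → ∑ n f ≈ 0#
  ∑-zero zero    f≈0 = refl
  ∑-zero (suc n) f≈0 = trans
    (+-cong (f≈0 0 (s≤s z≤n)) (∑-zero n λ i i<n → f≈0 (suc i) (s≤s i<n)))
    (+-identityˡ 0#)

  ∑-split : ∀ m n f → ∑ (m ℕ.+ n) f ≈ ∑ m f + ∑ n (λ i → f (m ℕ.+ i))
  ∑-split zero    n f = sym (+-identityˡ _)
  ∑-split (suc m) n f = trans (+-congˡ (∑-split m n (f ∘ suc))) (sym (+-assoc _ _ _))

  ∑-+ : ∀ n f g → ∑ n (λ i → f i + g i) ≈ ∑ n f + ∑ n g
  ∑-+ n f g = ∑-distrib-+ {n} (λ i → f (toℕ i)) (λ i → g (toℕ i))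

  ∑-*ˡ : ∀ n x f → ∑ n (λ i → x * f i) ≈ x * ∑ n f
  ∑-*ˡ n x f = sym (*-distribˡ-sum {n} x (λ i → f (toℕ i)))

  ∑-*ʳ : ∀ n x f → ∑ n (λ i → f i * x) ≈ ∑ n f * x
  ∑-*ʳ n x f = sym (*-distribʳ-sum {n} x (λ i → f (toℕ i)))

  ∑-swap : ∀ m n (f : ℕ → ℕ → Carrier) → ∑ m (λ i → ∑ n (f i)) ≈ ∑ n (λ j → ∑ m (λ i → f i j))
  ∑-swap m n f = ∑-comm {m} {n} (λ i j → f (toℕ i) (toℕ j))

  δ : ℕ → ℕ → Carrier
  δ zero    zero    = 1#
  δ zero    (suc n) = 0#
  δ (suc m) zero    = 0#
  δ (suc m) (suc n) = δ m n

  δ-≢ : ∀ m n → m ≢ n → δ m n ≈ 0#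
  δ-≢ zero    zero    m≢n = contradiction ≡.refl m≢n
  δ-≢ zero    (suc n) m≢n = refl
  δ-≢ (suc m) zero    m≢n = refl
  δ-≢ (suc m) (suc n) m≢n = δ-≢ m n (m≢n ∘ ≡.cong suc)

  ∑-δ : ∀ n m (f : ℕ → Carrier) → m < n → ∑ n (λ i → f i * δ m i) ≈ f m
  ∑-δ (suc n) zero    f m<n = trans
    (+-cong (*-identityʳ (f 0)) (∑-zero n λ i _ → zeroʳ (f (suc i)))) (+-identityʳ (f 0))
  ∑-δ (suc n) (suc m) f (s≤s m<n) = trans
    (+-cong (zeroʳ (f 0)) (∑-δ n m (f ∘ suc) m<n)) (+-identityˡ _)

  private
    module P = PowerSeriesRing raw laws
    module P-ring = CommutativeRing P.commutativeRing
  open PowerSeries raw using (Series; X; _⊛_; constant; rawRing)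
  open RawSemiringOps (RawRing.rawSemiring rawRing) using (_^_)

  X-⊛-suc : ∀ f n → (X ⊛ f) (suc n) ≈ f n
  X-⊛-suc f n = begin
    0# * f (suc n) + ((X ∘ suc) ⊛ f) n    ≈⟨ +-cong (zeroˡ (f (suc n))) (P.⊛-cong {X ∘ suc} {constant 1#} {f} X∘suc (λ _ → refl) n) ⟩
    0# + (constant 1# ⊛ f) n              ≈⟨ +-identityˡ _ ⟩
    (constant 1# ⊛ f) n                   ≈⟨ P.⊛-identityˡ f n ⟩
    f n                                   ∎
    where
    X∘suc : ∀ n → X (suc n) ≈ constant 1# n
    X∘suc zero    = refl
    X∘suc (suc n) = refl

  X^-coeff : ∀ m n → (X ^ m) n ≈ δ m n
  X^-coeff zero    zero    = refl
  X^-coeff zero    (suc n) = refl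
  X^-coeff (suc m) zero    = trans (P.⊛-zero X (X ^ m)) (zeroˡ _)
  X^-coeff (suc m) (suc n) = trans (X-⊛-suc (X ^ m) n) (X^-coeff m n)

  ∑-coeff : ∀ n (c : ℕ → Carrier) (p : ℕ → Series) l →
            SemiringSum.sum P-ring.semiring {n} (λ k → constant (c (toℕ k)) ⊛ p (toℕ k)) l ≈ ∑ n (λ k → c k * p k l)
  ∑-coeff n c p l = trans (P.sum-coeff n (λ k → constant (c k) ⊛ p k) l)
    (∑-cong n (λ k _ → P.constant-⊛ (c k) (p k) l))

-- q-Pochhammer symbols, q-binomials and interpolating Vandermonde sums

module qCalculus (raw : RawRing 0ℓ 0ℓ) (laws : RingLaws raw)
  (inv : RawRing.Carrier raw → RawRing.Carrier raw) (a q : RawRing.Carrier raw) where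

  private
    A : CommutativeRing 0ℓ 0ℓ
    A = bundle raw laws
  open CommutativeRing A hiding (zero)
  open Units A
  open IntegerSolver A
  open QBessel raw inv a q using (qPochhammer)
  open RawSemiringOps (RawRing.rawSemiring raw) using (_^_; product)
  open Exp commutativeSemiring using (^-homo-*)
  open import Relation.Binary.Reasoning.Setoid setoid

  product-cong : ∀ n {f g : ℕ → Carrier} → (∀ i → f i ≈ g i) → product {n} (f ∘ toℕ) ≈ product {n} (g ∘ toℕ)
  product-cong n f≈g = MonoidSum.sum-cong-≋ *-monoid {n} (λ i → f≈g (toℕ i))

  qPochhammer-cong : ∀ {x y} n → x ≈ y → qPochhammer x n ≈ qPochhammer y n
  qPochhammer-cong n x≈y = product-cong n λ i → +-congˡ (-‿cong (*-congʳ {q ^ i} x≈y))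

  qPochhammer-suc : ∀ x n → qPochhammer x (suc n) ≈ (1# + - x) * qPochhammer (x * q) n
  qPochhammer-suc x n = *-cong (+-congˡ (-‿cong (*-identityʳ x)))
    (product-cong n λ i → +-congˡ (-‿cong (sym (*-assoc x q (q ^ i)))))

  qPochhammer-+ : ∀ x m n → qPochhammer x (m ℕ.+ n) ≈ qPochhammer x m * qPochhammer (x * q ^ m) n
  qPochhammer-+ x zero    n = trans (qPochhammer-cong n (sym (*-identityʳ x))) (sym (*-identityˡ _))
  qPochhammer-+ x (suc m) n = begin
    qPochhammer x (suc m ℕ.+ n)                                               ≈⟨ qPochhammer-suc x (m ℕ.+ n) ⟩
    (1# + - x) * qPochhammer (x * q) (m ℕ.+ n)                                ≈⟨ *-congˡ (qPochhammer-+ (x * q) m n) ⟩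
    (1# + - x) * (qPochhammer (x * q) m * qPochhammer (x * q * q ^ m) n)      ≈⟨ *-assoc _ _ _ ⟨
    (1# + - x) * qPochhammer (x * q) m * qPochhammer (x * q * q ^ m) n        ≈⟨ *-cong (sym (qPochhammer-suc x m)) (qPochhammer-cong n (*-assoc x q (q ^ m))) ⟩
    qPochhammer x (suc m) * qPochhammer (x * q ^ suc m) n                     ∎

  qPochhammer-sucʳ : ∀ x n → qPochhammer x (suc n) ≈ qPochhammer x n * (1# + - (x * q ^ n))
  qPochhammer-sucʳ x n = begin
    qPochhammer x (suc n)                                  ≡⟨ ≡.cong (qPochhammer x) (ℕₚ.+-comm 1 n) ⟩
    qPochhammer x (n ℕ.+ 1)                                ≈⟨ qPochhammer-+ x n 1 ⟩
    qPochhammer x n * ((1# + - (x * q ^ n * 1#)) * 1#)     ≈⟨ *-congˡ (trans (*-identityʳ _) (+-congˡ (-‿cong (*-identityʳ _)))) ⟩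
    qPochhammer x n * (1# + - (x * q ^ n))                 ∎

  qPochhammer-unit : ∀ x n → (∀ i → Unit A (1# + - (x * q ^ i))) → Unit A (qPochhammer x n)
  qPochhammer-unit x zero    u = 1-unit
  qPochhammer-unit x (suc n) u = unit-resp (sym (qPochhammer-sucʳ x n)) (*-unit (qPochhammer-unit x n u) (u n))

  qPochhammer-0 : ∀ n → qPochhammer 0# n ≈ 1#
  qPochhammer-0 zero    = refl
  qPochhammer-0 (suc n) = trans (qPochhammer-sucʳ 0# n) (trans (*-congʳ (qPochhammer-0 n))
    (solve 1 (λ x → :1 :* (:1 :+ :- (:0 :* x)) := :1) refl (q ^ n)))

  qPochhammer-1 : ∀ n → qPochhammer 1# (suc n) ≈ 0#
  qPochhammer-1 n = trans (qPochhammer-suc 1# n) (trans (*-congʳ (-‿inverseʳ 1#)) (zeroˡ _))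

  -- The q-Pascal rule serves as definition, so no division occurs; `qBinomial-factorial` recovers
  -- the quotient formula with denominators cleared.
  qBinomial : ℕ → ℕ → Carrier
  qBinomial n       zero    = 1#
  qBinomial zero    (suc m) = 0#
  qBinomial (suc n) (suc m) = q ^ suc m * qBinomial n (suc m) + qBinomial n m

  qBinomial-< : ∀ n m → n < m → qBinomial n m ≈ 0#
  qBinomial-< zero    (suc m) n<m       = refl
  qBinomial-< (suc n) (suc m) (s≤s n<m) = begin
    q ^ suc m * qBinomial n (suc m) + qBinomial n m    ≈⟨ +-cong (*-congˡ (qBinomial-< n (suc m) (ℕₚ.m≤n⇒m≤1+n n<m))) (qBinomial-< n m n<m) ⟩
    q ^ suc m * 0# + 0#                                ≈⟨ trans (+-identityʳ _) (zeroʳ _) ⟩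
    0#                                                 ∎

  qBinomial-diag : ∀ n → qBinomial n n ≈ 1#
  qBinomial-diag zero    = refl
  qBinomial-diag (suc n) = begin
    q ^ suc n * qBinomial n (suc n) + qBinomial n n    ≈⟨ +-cong (*-congˡ (qBinomial-< n (suc n) ℕₚ.≤-refl)) (qBinomial-diag n) ⟩
    q ^ suc n * 0# + 1#                                ≈⟨ trans (+-congʳ (zeroʳ _)) (+-identityˡ _) ⟩
    1#                                                 ∎

  qBinomial-factorial : ∀ s m → qBinomial (s ℕ.+ m) s * (qPochhammer q s * qPochhammer q m) ≈ qPochhammer q (s ℕ.+ m)
  qBinomial-factorial zero    m = trans (*-identityˡ _) (*-identityˡ _)
  qBinomial-factorial (suc s) zero = begin
    qBinomial (suc s ℕ.+ 0) (suc s) * (qPochhammer q (suc s) * 1#)   ≡⟨ ≡.cong (λ n → qBinomial n (suc s) * (qPochhammer q (suc s) * 1#)) (ℕₚ.+-identityʳ (suc s)) ⟩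
    qBinomial (suc s) (suc s) * (qPochhammer q (suc s) * 1#)         ≈⟨ *-cong (qBinomial-diag (suc s)) (*-identityʳ _) ⟩
    1# * qPochhammer q (suc s)                                       ≈⟨ *-identityˡ _ ⟩
    qPochhammer q (suc s)                                            ≡⟨ ≡.cong (qPochhammer q) (ℕₚ.+-identityʳ (suc s)) ⟨
    qPochhammer q (suc s ℕ.+ 0)                                      ∎
  qBinomial-factorial (suc s) (suc m) = begin
    (q ^ suc s * B₁ + B₂) * (qPochhammer q (suc s) * qPochhammer q (suc m))
      ≈⟨ solve 5 (λ x b₁ b₂ p p′ → (x :* b₁ :+ b₂) :* (p :* p′) := x :* (b₁ :* (p :* p′)) :+ b₂ :* (p :* p′)) refl (q ^ suc s) B₁ B₂ (qPochhammer q (suc s)) (qPochhammer q (suc m)) ⟩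
    q ^ suc s * (B₁ * (qPochhammer q (suc s) * qPochhammer q (suc m))) + B₂ * (qPochhammer q (suc s) * qPochhammer q (suc m))
      ≈⟨ +-cong (*-congˡ (*-congˡ (*-congˡ (qPochhammer-sucʳ q m)))) (*-congˡ (*-congʳ (qPochhammer-sucʳ q s))) ⟩
    q ^ suc s * (B₁ * (qPochhammer q (suc s) * (qPochhammer q m * (1# + - (q * q ^ m))))) + B₂ * (qPochhammer q s * (1# + - (q * q ^ s)) * qPochhammer q (suc m))
      ≈⟨ solve 8 (λ x b₁ b₂ p p′ r r′ y → x :* (b₁ :* (p :* (p′ :* (:1 :+ :- y)))) :+ b₂ :* (r :* (:1 :+ :- x) :* r′)
                   := x :* (:1 :+ :- y) :* (b₁ :* (p :* p′)) :+ (:1 :+ :- x) :* (b₂ :* (r :* r′))) refl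
           (q ^ suc s) B₁ B₂ (qPochhammer q (suc s)) (qPochhammer q m) (qPochhammer q s) (qPochhammer q (suc m)) (q ^ suc m) ⟩
    q ^ suc s * (1# + - q ^ suc m) * (B₁ * (qPochhammer q (suc s) * qPochhammer q m)) + (1# + - q ^ suc s) * (B₂ * (qPochhammer q s * qPochhammer q (suc m)))
      ≈⟨ +-cong (*-congˡ (trans (*-congʳ (reflexive (≡.cong (λ n → qBinomial n (suc s)) (ℕₚ.+-suc s m)))) (qBinomial-factorial (suc s) m))) (*-congˡ (qBinomial-factorial s (suc m))) ⟩
    q ^ suc s * (1# + - q ^ suc m) * qPochhammer q (suc s ℕ.+ m) + (1# + - q ^ suc s) * qPochhammer q (s ℕ.+ suc m)
      ≈⟨ +-congʳ (*-congˡ (reflexive (≡.cong (qPochhammer q) (≡.sym (ℕₚ.+-suc s m))))) ⟩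
    q ^ suc s * (1# + - q ^ suc m) * qPochhammer q (s ℕ.+ suc m) + (1# + - q ^ suc s) * qPochhammer q (s ℕ.+ suc m)
      -- q^(s+1) (1 - q^(m+1)) + (1 - q^(s+1)) = 1 - q^(s+m+2).
      ≈⟨ solve 3 (λ x y p → x :* (:1 :+ :- y) :* p :+ (:1 :+ :- x) :* p := p :* (:1 :+ :- (x :* y))) refl (q ^ suc s) (q ^ suc m) (qPochhammer q (s ℕ.+ suc m)) ⟩
    qPochhammer q (s ℕ.+ suc m) * (1# + - (q ^ suc s * q ^ suc m))
      ≈⟨ *-congˡ (+-congˡ (-‿cong (^-homo-* q (suc s) (suc m)))) ⟨
    qPochhammer q (s ℕ.+ suc m) * (1# + - (q * q ^ (s ℕ.+ suc m)))
      ≈⟨ qPochhammer-sucʳ q (s ℕ.+ suc m) ⟨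
    qPochhammer q (suc (s ℕ.+ suc m)) ∎
    where
    B₁ B₂ : Carrier
    B₁ = qBinomial (s ℕ.+ suc m) (suc s)
    B₂ = qBinomial (s ℕ.+ suc m) s

  -- Σᵣ yʳ q^{(j−r)(m−r)} [j,r] [l,m−r], which interpolates between [l,m] at j = 0 and
  -- yᵐ [j,m] at l = 0.
  vandermonde : Carrier → ℕ → ℕ → ℕ → Carrier
  vandermonde y zero    l m       = qBinomial l m
  vandermonde y (suc j) l zero    = 1#
  vandermonde y (suc j) l (suc m) = q ^ suc m * vandermonde y j l (suc m) + y * vandermonde y j l m

  vandermonde-cong : ∀ {x y} j l m → x ≈ y → vandermonde x j l m ≈ vandermonde y j l m
  vandermonde-cong zero    l m       x≈y = refl
  vandermonde-cong (suc j) l zero    x≈y = refl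
  vandermonde-cong (suc j) l (suc m) x≈y = +-cong (*-congˡ (vandermonde-cong j l (suc m) x≈y))
    (*-cong x≈y (vandermonde-cong j l m x≈y))

  vandermonde-zero : ∀ y j l → vandermonde y j l 0 ≈ 1#
  vandermonde-zero y zero    l = refl
  vandermonde-zero y (suc j) l = refl

  vandermonde-full : ∀ y j m → vandermonde y j 0 m ≈ y ^ m * qBinomial j m
  vandermonde-full y zero    zero    = sym (*-identityˡ 1#)
  vandermonde-full y zero    (suc m) = sym (zeroʳ _)
  vandermonde-full y (suc j) zero    = sym (*-identityˡ 1#)
  vandermonde-full y (suc j) (suc m) = begin
    q ^ suc m * vandermonde y j 0 (suc m) + y * vandermonde y j 0 m
      ≈⟨ +-cong (*-congˡ (vandermonde-full y j (suc m))) (*-congˡ (vandermonde-full y j m)) ⟩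
    q ^ suc m * (y * y ^ m * qBinomial j (suc m)) + y * (y ^ m * qBinomial j m)
      ≈⟨ solve 5 (λ x y z b c → x :* (y :* z :* b) :+ y :* (z :* c) := y :* z :* (x :* b :+ c)) refl (q ^ suc m) y (y ^ m) (qBinomial j (suc m)) (qBinomial j m) ⟩
    y * y ^ m * (q ^ suc m * qBinomial j (suc m) + qBinomial j m) ∎

  -- Moving one unit from `l` to `j` is free when q y = 1, and in general leaves a defect
  -- proportional to 1 - q y. The defect has argument y instead of q y because the recursion
  -- coefficients q^(m+2) and q y are q times q^(m+1) and y; the extracted q raises q^j to q^(j+1).
  vandermonde-step : ∀ y j l m →
    vandermonde (q * y) j (suc l) (suc m) ≈
    vandermonde (q * y) (suc j) l (suc m) + q ^ j * (1# + - (q * y)) * vandermonde y j l m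
  vandermonde-step y zero l m =
    solve 4 (λ x y b c → x :* b :+ c := x :* b :+ y :* c :+ :1 :* (:1 :+ :- y) :* c) refl (q ^ suc m) (q * y) (qBinomial l (suc m)) (qBinomial l m)
  vandermonde-step y (suc j) l zero = begin
    q ^ 1 * vandermonde (q * y) j (suc l) 1 + q * y * vandermonde (q * y) j (suc l) 0
      ≈⟨ +-cong (*-congˡ (trans (vandermonde-step y j l 0) (+-congˡ (*-congˡ (vandermonde-zero y j l))))) (*-congˡ (vandermonde-zero (q * y) j (suc l))) ⟩
    q ^ 1 * (vandermonde (q * y) (suc j) l 1 + q ^ j * (1# + - (q * y)) * 1#) + q * y * 1#
      ≈⟨ solve 4 (λ q y v u → q :* :1 :* (v :+ u :* (:1 :+ :- (q :* y)) :* :1) :+ q :* y :* :1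
                   := q :* :1 :* v :+ q :* y :* :1 :+ q :* u :* (:1 :+ :- (q :* y)) :* :1) refl q y (vandermonde (q * y) (suc j) l 1) (q ^ j) ⟩
    q ^ 1 * vandermonde (q * y) (suc j) l 1 + q * y * 1# + q * q ^ j * (1# + - (q * y)) * 1# ∎
  vandermonde-step y (suc j) l (suc m) = begin
    q ^ suc (suc m) * vandermonde (q * y) j (suc l) (suc (suc m)) + q * y * vandermonde (q * y) j (suc l) (suc m)
      ≈⟨ +-cong (*-congˡ (vandermonde-step y j l (suc m))) (*-congˡ (vandermonde-step y j l m)) ⟩
    q ^ suc (suc m) * (v₁ + q ^ j * (1# + - (q * y)) * v₂) + q * y * (v₃ + q ^ j * (1# + - (q * y)) * v₄)
      ≈⟨ solve 8 (λ q x u y v₁ v₂ v₃ v₄ →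
           q :* x :* (v₁ :+ u :* (:1 :+ :- (q :* y)) :* v₂) :+ q :* y :* (v₃ :+ u :* (:1 :+ :- (q :* y)) :* v₄)
           := q :* x :* v₁ :+ q :* y :* v₃ :+ q :* u :* (:1 :+ :- (q :* y)) :* (x :* v₂ :+ y :* v₄)) refl
           q (q ^ suc m) (q ^ j) y v₁ v₂ v₃ v₄ ⟩
    q ^ suc (suc m) * v₁ + q * y * v₃ + q * q ^ j * (1# + - (q * y)) * (q ^ suc m * v₂ + y * v₄) ∎
    where
    v₁ v₂ v₃ v₄ : Carrier
    v₁ = vandermonde (q * y) (suc j) l (suc (suc m))
    v₂ = vandermonde y j l (suc m)
    v₃ = vandermonde (q * y) (suc j) l (suc m)
    v₄ = vandermonde y j l m

-- Path sums and moments over an abstract ring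

module MixedMoments (raw : RawRing 0ℓ 0ℓ) (laws : RingLaws raw)
  (inv : RawRing.Carrier raw → RawRing.Carrier raw) (*-inverse : InvertsUnits (bundle raw laws) inv)
  (a q : RawRing.Carrier raw)
  (q-unit : Unit (bundle raw laws) q) (1-q^-unit : UnitDifferences (bundle raw laws) q)
  (1+a-unit : ∀ z → Unit (bundle raw laws) (RawRing._+_ raw (RawRing.1# raw) (RawRing._*_ raw a z)))
  where

  private
    A : CommutativeRing 0ℓ 0ℓ
    A = bundle raw laws
  open CommutativeRing A hiding (zero)
  open RawSemiringOps (RawRing.rawSemiring raw) using (_^_)
  open Units A
  open Sums raw laws
  open IntegerSolver A
  open QBessel raw inv a q
  open qCalculus raw laws inv a q
  open Exp commutativeSemiring using (^-homo-*; ^-distrib-*; ^-congˡ)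
  open import Relation.Binary.Reasoning.Setoid setoid

  inv-unique : ∀ {x y} → x * y ≈ 1# → inv x ≈ y
  inv-unique {x} {y} xy≈1 = unit-cancelˡ (y , xy≈1) (inv x) y (trans (*-inverse x (y , xy≈1)) (sym xy≈1))

  inv-cong : ∀ {x y} → Unit A x → x ≈ y → inv x ≈ inv y
  inv-cong {x} {y} x-unit x≈y = inv-unique (trans (*-congʳ x≈y) (*-inverse y (unit-resp x≈y x-unit)))

  inv-unit : ∀ {x} → Unit A x → Unit A (inv x)
  inv-unit {x} x-unit = x , trans (*-comm (inv x) x) (*-inverse x x-unit)

  ^-unit : ∀ {x} n → Unit A x → Unit A (x ^ n)
  ^-unit zero    x-unit = 1-unit
  ^-unit (suc n) x-unit = *-unit x-unit (^-unit n x-unit)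

  1^n≈1 : ∀ n → 1# ^ n ≈ 1#
  1^n≈1 zero    = refl
  1^n≈1 (suc n) = trans (*-identityˡ _) (1^n≈1 n)

  q-qPochhammer-unit : ∀ n → Unit A (qPochhammer q n)
  q-qPochhammer-unit n = qPochhammer-unit q n 1-q^-unit

  -- `1+a-unit` places a in the Jacobson radical; it is the form in which the smallness of the
  -- series variable enters the abstract ring.
  a-qPochhammer-unit : ∀ c n → Unit A (qPochhammer (- (a * c)) n)
  a-qPochhammer-unit c n = qPochhammer-unit (- (a * c)) n λ i → unit-resp
    (solve 3 (λ a c x → :1 :+ a :* (c :* x) := :1 :+ :- (:- (a :* c) :* x)) refl a c (q ^ i)) (1+a-unit (c * q ^ i))

  -- Path generating functions

  y : ℕ → ℕ → Carrier
  y k m = - (a * (q ^ (2 ℕ.* k) * q ^ m))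

  y-suc : ∀ k m → y k (suc m) ≈ q * y k m
  y-suc k m = solve 4 (λ a q u v → :- (a :* (u :* (q :* v))) := q :* :- (a :* (u :* v))) refl a q (q ^ (2 ℕ.* k)) (q ^ m)

  D : ℕ → ℕ → Carrier
  D k m = qPochhammer (y k 1) m

  D-unit : ∀ k m → Unit A (D k m)
  D-unit k m = a-qPochhammer-unit (q ^ (2 ℕ.* k) * q ^ 1) m

  D-suc : ∀ k m → D k (suc m) ≈ (1# + - (q * y k m)) * D k m
  D-suc k m = trans (qPochhammer-sucʳ (y k 1) m)
    (solve 5 (λ a q u v d → d :* (:1 :+ :- (:- (a :* (u :* (q :* :1))) :* v)) := (:1 :+ :- (q :* :- (a :* (u :* v)))) :* d) refl a q (q ^ (2 ℕ.* k)) (q ^ m) (D k m))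

  -- The last factor of the longer denominator is precisely the defect factor of `vandermonde-step`.
  inv-D-suc : ∀ k m → (1# + - (q * y k m)) * inv (D k (suc m)) ≈ inv (D k m)
  inv-D-suc k m = sym (inv-unique (begin
    D k m * ((1# + - (q * y k m)) * inv (D k (suc m)))    ≈⟨ solve 3 (λ d z e → d :* (z :* e) := z :* d :* e) refl (D k m) (1# + - (q * y k m)) (inv (D k (suc m))) ⟩
    (1# + - (q * y k m)) * D k m * inv (D k (suc m))      ≈⟨ *-congʳ (D-suc k m) ⟨
    D k (suc m) * inv (D k (suc m))                       ≈⟨ *-inverse _ (D-unit k (suc m)) ⟩
    1#                                                    ∎))

  -- With m = i − k and j + l = i, the sum of the weights of the paths from (k , ∞) to v^t_{i,j}.
  pathSum : ℕ → ℕ → ℕ → ℕ → ℕ → Carrier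
  pathSum k t m j l = (y k m ^ m) ^ t * (vandermonde (y k m) j l m * inv (D k m))

  pathSum-rest : ∀ k t j l → pathSum k t 0 j l ≈ 1#
  pathSum-rest k t j l = begin
    1# ^ t * (vandermonde (y k 0) j l 0 * inv 1#)   ≈⟨ *-cong (1^n≈1 t) (*-cong (vandermonde-zero (y k 0) j l) (inv-unique (*-identityˡ 1#))) ⟩
    1# * (1# * 1#)                                  ≈⟨ trans (*-identityˡ _) (*-identityˡ _) ⟩
    1#                                              ∎

  -- At the top of a level the Vandermonde sum has collapsed to y^m [i,m], and this y^m accounts for
  -- the additional level.
  pathSum-wrap : ∀ k t m i → pathSum k t m i 0 ≈ pathSum k (suc t) m 0 i
  pathSum-wrap k t m i = begin
    (y k m ^ m) ^ t * (vandermonde (y k m) i 0 m * inv (D k m))             ≈⟨ *-congˡ (*-congʳ (vandermonde-full (y k m) i m)) ⟩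
    (y k m ^ m) ^ t * (y k m ^ m * qBinomial i m * inv (D k m))             ≈⟨ solve 4 (λ x c b d → x :* (c :* b :* d) := c :* x :* (b :* d)) refl ((y k m ^ m) ^ t) (y k m ^ m) (qBinomial i m) (inv (D k m)) ⟩
    y k m ^ m * (y k m ^ m) ^ t * (qBinomial i m * inv (D k m))             ∎

  -- The factor y^m gained per level changes between neighbouring columns by exactly the base of the
  -- t-th power in the east weight: q^(m+1) y = -a q^(2k+2m+1), with i = m + k.
  weight-base : ∀ k m → y k (suc m) ^ suc m ≈ - (a * q ^ (2 ℕ.* (m ℕ.+ k) ℕ.+ 1)) * y k m ^ m
  weight-base k m = begin
    y k (suc m) ^ suc m                  ≈⟨ ^-congˡ (suc m) (y-suc k m) ⟩
    q * y k m * (q * y k m) ^ m          ≈⟨ *-congˡ (^-distrib-* q (y k m) m) ⟩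
    q * y k m * (q ^ m * y k m ^ m)      ≈⟨ solve 5 (λ a q u v w → q :* :- (a :* (u :* v)) :* (v :* w) := :- (a :* (u :* (v :* (v :* (q :* :1))))) :* w) refl a q (q ^ (2 ℕ.* k)) (q ^ m) (y k m ^ m) ⟩
    - (a * (q ^ (2 ℕ.* k) * (q ^ m * (q ^ m * q ^ 1)))) * y k m ^ m
      ≈⟨ *-congʳ (-‿cong (*-congˡ (trans (*-congˡ (trans (*-congˡ (sym (^-homo-* q m 1))) (sym (^-homo-* q m (m ℕ.+ 1))))) (sym (^-homo-* q (2 ℕ.* k) _))))) ⟩
    - (a * q ^ (2 ℕ.* k ℕ.+ (m ℕ.+ (m ℕ.+ 1)))) * y k m ^ m
      ≡⟨ ≡.cong (λ n → - (a * q ^ n) * y k m ^ m) (exponent k m) ⟩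
    - (a * q ^ (2 ℕ.* (m ℕ.+ k) ℕ.+ 1)) * y k m ^ m  ∎
    where
    open import Data.Nat.Solver using (module +-*-Solver)
    module N = +-*-Solver
    exponent : ∀ k m → 2 ℕ.* k ℕ.+ (m ℕ.+ (m ℕ.+ 1)) ≡ 2 ℕ.* (m ℕ.+ k) ℕ.+ 1
    exponent = N.solve 2 (λ k m → N.con 2 N.:* k N.:+ (m N.:+ (m N.:+ N.con 1)) N.:= N.con 2 N.:* (m N.:+ k) N.:+ N.con 1) ≡.refl

  pathSum-step : ∀ k t m j l → pathSum k t (suc m) j (suc l) ≈
    pathSum k t (suc m) (suc j) l + ((- (a * q ^ (2 ℕ.* (m ℕ.+ k) ℕ.+ 1))) ^ t * q ^ j) * pathSum k t m j l
  pathSum-step k t m j l = begin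
    cᵗ * (vandermonde (y k (suc m)) j (suc l) (suc m) * I)
      ≈⟨ *-congˡ (*-congʳ (vandermonde-cong j (suc l) (suc m) (y-suc k m))) ⟩
    cᵗ * (vandermonde (q * y k m) j (suc l) (suc m) * I)
      ≈⟨ *-congˡ (*-congʳ (vandermonde-step (y k m) j l m)) ⟩
    cᵗ * ((vandermonde (q * y k m) (suc j) l (suc m) + q ^ j * z * v) * I)
      ≈⟨ *-congˡ (*-congʳ (+-congʳ (vandermonde-cong (suc j) l (suc m) (sym (y-suc k m))))) ⟩
    cᵗ * ((vandermonde (y k (suc m)) (suc j) l (suc m) + q ^ j * z * v) * I)
      ≈⟨ solve 6 (λ c u r z v i → c :* ((u :+ r :* z :* v) :* i) := c :* (u :* i) :+ c :* (r :* (v :* (z :* i)))) refl cᵗ (vandermonde (y k (suc m)) (suc j) l (suc m)) (q ^ j) z v I ⟩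
    pathSum k t (suc m) (suc j) l + cᵗ * (q ^ j * (v * (z * I)))
      ≈⟨ +-congˡ (*-cong (trans (^-congˡ t (weight-base k m)) (^-distrib-* b (y k m ^ m) t)) (*-congˡ (*-congˡ (inv-D-suc k m)))) ⟩
    pathSum k t (suc m) (suc j) l + b ^ t * (y k m ^ m) ^ t * (q ^ j * (v * inv (D k m)))
      ≈⟨ +-congˡ (solve 5 (λ b c r v i → b :* c :* (r :* (v :* i)) := b :* r :* (c :* (v :* i))) refl (b ^ t) ((y k m ^ m) ^ t) (q ^ j) v (inv (D k m))) ⟩
    pathSum k t (suc m) (suc j) l + (b ^ t * q ^ j) * pathSum k t m j l ∎
    where
    cᵗ I z v b : Carrier
    cᵗ = (y k (suc m) ^ suc m) ^ t
    I = inv (D k (suc m))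
    z = 1# + - (q * y k m)
    v = vandermonde (y k m) j l m
    b = - (a * q ^ (2 ℕ.* (m ℕ.+ k) ℕ.+ 1))

  -- Inversion of the coefficient matrix

  Q : Carrier
  Q = inv q

  qQ≈1 : q * Q ≈ 1#
  qQ≈1 = *-inverse q q-unit

  q^n*Q^n≈1 : ∀ n → q ^ n * Q ^ n ≈ 1#
  q^n*Q^n≈1 n = trans (sym (^-distrib-* q Q n)) (trans (^-congˡ n qQ≈1) (1^n≈1 n))

  -- c N s is the coefficient (q^{-N};q)ₛ qˢ / (q;q)ₛ of zˢ in Π_{i<N} (1 − q^{-i} z).
  c : ℕ → ℕ → Carrier
  c zero    zero    = 1#
  c zero    (suc s) = 0#
  c (suc N) zero    = 1#
  c (suc N) (suc s) = c N (suc s) + - (Q ^ N * c N s)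

  c-zero : ∀ N → c N 0 ≈ 1#
  c-zero zero    = refl
  c-zero (suc N) = refl

  c-> : ∀ N s → N < s → c N s ≈ 0#
  c-> zero    (suc s) N<s       = refl
  c-> (suc N) (suc s) (s≤s N<s) = begin
    c N (suc s) + - (Q ^ N * c N s)    ≈⟨ +-cong (c-> N (suc s) (ℕₚ.m≤n⇒m≤1+n N<s)) (-‿cong (*-congˡ (c-> N s N<s))) ⟩
    0# + - (Q ^ N * 0#)                ≈⟨ solve 1 (λ x → :0 :+ :- (x :* :0) := :0) refl (Q ^ N) ⟩
    0#                                 ∎

  c-qPochhammer : ∀ N s → qPochhammer (Q ^ N) s * q ^ s ≈ c N s * qPochhammer q s
  c-qPochhammer zero    zero    = refl
  c-qPochhammer zero    (suc s) = trans (*-congʳ (qPochhammer-1 s)) (trans (zeroˡ _) (sym (zeroˡ _)))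
  c-qPochhammer (suc N) zero    = refl
  c-qPochhammer (suc N) (suc s) = begin
    qPochhammer (Q ^ suc N) (suc s) * q ^ suc s
      ≈⟨ *-congʳ (trans (qPochhammer-suc (Q ^ suc N) s) (*-congˡ (qPochhammer-cong s shift))) ⟩
    (1# + - (Q * V)) * x * (q * u)
      ≈⟨ solve 5 (λ q Q V x u → (:1 :+ :- (Q :* V)) :* x :* (q :* u) := x :* u :* (q :- (q :* Q) :* V)) refl q Q V x u ⟩
    x * u * (q - q * Q * V)
      ≈⟨ *-congˡ (+-congˡ (-‿cong (trans (*-congʳ qQ≈1) (*-identityˡ V)))) ⟩
    x * u * (q - V)
      -- The split q - V = q (1 - V u) - V (1 - q u) produces the two terms of the recursion for
      -- `c`.
      ≈⟨ solve 4 (λ q V x u → x :* u :* (q :- V) := x :* (:1 :+ :- (V :* u)) :* (q :* u) :+ :- (V :* (:1 :+ :- (q :* u)) :* (x :* u))) refl q V x u ⟩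
    x * (1# + - (V * u)) * (q * u) + - (V * (1# + - (q * u)) * (x * u))
      ≈⟨ +-cong (trans (*-congʳ (sym (qPochhammer-sucʳ V s))) (c-qPochhammer N (suc s))) (-‿cong (*-congˡ (c-qPochhammer N s))) ⟩
    c N (suc s) * qPochhammer q (suc s) + - (V * (1# + - (q * u)) * (c N s * qPochhammer q s))
      ≈⟨ +-congʳ (*-congˡ (qPochhammer-sucʳ q s)) ⟩
    c N (suc s) * (qPochhammer q s * (1# + - (q * u))) + - (V * (1# + - (q * u)) * (c N s * qPochhammer q s))
      ≈⟨ solve 5 (λ c₁ c₂ r z V → c₁ :* (r :* z) :+ :- (V :* z :* (c₂ :* r)) := (c₁ :+ :- (V :* c₂)) :* (r :* z)) refl (c N (suc s)) (c N s) (qPochhammer q s) (1# + - (q * u)) V ⟩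
    (c N (suc s) + - (V * c N s)) * (qPochhammer q s * (1# + - (q * u)))
      ≈⟨ *-congˡ (qPochhammer-sucʳ q s) ⟨
    c (suc N) (suc s) * qPochhammer q (suc s) ∎
    where
    V x u : Carrier
    V = Q ^ N
    x = qPochhammer V s
    u = q ^ s
    shift : Q ^ suc N * q ≈ V
    shift = trans (solve 3 (λ Q V q → Q :* V :* q := q :* Q :* V) refl Q V q) (trans (*-congʳ qQ≈1) (*-identityˡ V))

  -- The operator Π_{i<N} (1 − q^{-i} E), where E is the shift, evaluated at 0.
  Δ : ℕ → (ℕ → Carrier) → Carrier
  Δ zero    f = f 0
  Δ (suc N) f = Δ N (λ s → f s + - (Q ^ N * f (suc s)))

  Δ-cong : ∀ N {f g : ℕ → Carrier} → (∀ s → f s ≈ g s) → Δ N f ≈ Δ N g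
  Δ-cong zero    f≈g = f≈g 0
  Δ-cong (suc N) f≈g = Δ-cong N (λ s → +-cong (f≈g s) (-‿cong (*-congˡ (f≈g (suc s)))))

  Δ-* : ∀ N x f → Δ N (λ s → x * f s) ≈ x * Δ N f
  Δ-* zero    x f = refl
  Δ-* (suc N) x f = trans
    (Δ-cong N (λ s → solve 4 (λ x u v w → x :* u :+ :- (v :* (x :* w)) := x :* (u :+ :- (v :* w))) refl x (f s) (Q ^ N) (f (suc s))))
    (Δ-* N x _)

  Δ-∑ : ∀ N B f → N < B → Δ N f ≈ ∑ B (λ s → c N s * f s)
  Δ-∑ zero    (suc B) f N<B = sym (trans
    (+-cong (*-identityˡ (f 0)) (∑-zero B λ i _ → zeroˡ (f (suc i)))) (+-identityʳ (f 0)))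
  Δ-∑ (suc N) (suc B) f (s≤s N<B) = begin
    Δ N (λ s → f s + - (Q ^ N * f (suc s)))
      ≈⟨ Δ-∑ N (suc B) _ (ℕₚ.m≤n⇒m≤1+n N<B) ⟩
    ∑ (suc B) (λ s → c N s * (f s + - (Q ^ N * f (suc s))))
      ≈⟨ ∑-cong (suc B) (λ s _ → solve 4 (λ c u v w → c :* (u :+ :- (v :* w)) := c :* u :+ (:- v) :* (c :* w)) refl (c N s) (f s) (Q ^ N) (f (suc s))) ⟩
    ∑ (suc B) (λ s → c N s * f s + - (Q ^ N) * (c N s * f (suc s)))
      ≈⟨ trans (∑-+ (suc B) (λ s → c N s * f s) (λ s → - (Q ^ N) * (c N s * f (suc s)))) (+-congˡ (∑-*ˡ (suc B) (- (Q ^ N)) (λ s → c N s * f (suc s)))) ⟩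
    ∑ (suc B) (λ s → c N s * f s) + - (Q ^ N) * ∑ (suc B) (λ s → c N s * f (suc s))
      -- Going through `Δ` and back removes the last term, where `c N B` vanishes, so that the two
      -- sums can be merged index by index.
      ≈⟨ +-congˡ (*-congˡ (trans (sym (Δ-∑ N (suc B) (f ∘ suc) (ℕₚ.m≤n⇒m≤1+n N<B))) (Δ-∑ N B (f ∘ suc) N<B))) ⟩
    ∑ (suc B) (λ s → c N s * f s) + - (Q ^ N) * ∑ B (λ s → c N s * f (suc s))
      ≈⟨ +-cong (+-congʳ (*-congʳ (c-zero N))) (sym (∑-*ˡ B (- (Q ^ N)) (λ s → c N s * f (suc s)))) ⟩
    (1# * f 0 + ∑ B (λ s → c N (suc s) * f (suc s))) + ∑ B (λ s → - (Q ^ N) * (c N s * f (suc s)))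
      ≈⟨ trans (+-assoc _ _ _) (+-congˡ (sym (∑-+ B (λ s → c N (suc s) * f (suc s)) (λ s → - (Q ^ N) * (c N s * f (suc s)))))) ⟩
    1# * f 0 + ∑ B (λ s → c N (suc s) * f (suc s) + - (Q ^ N) * (c N s * f (suc s)))
      ≈⟨ +-congˡ (∑-cong B λ s _ → solve 4 (λ c₁ c₂ v w → c₁ :* w :+ (:- v) :* (c₂ :* w) := (c₁ :+ :- (v :* c₂)) :* w) refl (c N (suc s)) (c N s) (Q ^ N) (f (suc s))) ⟩
    1# * f 0 + ∑ B (λ s → c (suc N) (suc s) * f (suc s)) ∎

  -- (b qˢ;q)_N is a polynomial of degree N in qˢ, and the operator kills qˢᵈ for d ≤ N.
  Δ-qPochhammer : ∀ N b → Δ (suc N) (λ s → qPochhammer (b * q ^ s) N) ≈ 0#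
  Δ-qPochhammer zero    b = solve 0 (:1 :+ :- (:1 :* :1) := :0) refl
  Δ-qPochhammer (suc N) b = begin
    Δ (suc N) (λ s → qPochhammer (b * q ^ s) (suc N) + - (Q ^ suc N * qPochhammer (b * q ^ suc s) (suc N)))
      ≈⟨ Δ-cong (suc N) difference ⟩
    Δ (suc N) (λ s → (1# + - (Q ^ suc N)) * qPochhammer (b * q * q ^ s) N)
      ≈⟨ Δ-* (suc N) (1# + - (Q ^ suc N)) (λ s → qPochhammer (b * q * q ^ s) N) ⟩
    (1# + - (Q ^ suc N)) * Δ (suc N) (λ s → qPochhammer (b * q * q ^ s) N)
      ≈⟨ trans (*-congˡ (Δ-qPochhammer N (b * q))) (zeroʳ _) ⟩
    0# ∎
    where
    difference : ∀ s → qPochhammer (b * q ^ s) (suc N) + - (Q ^ suc N * qPochhammer (b * q ^ suc s) (suc N))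
                     ≈ (1# + - (Q ^ suc N)) * qPochhammer (b * q * q ^ s) N
    difference s = begin
      qPochhammer (b * q ^ s) (suc N) + - (Q ^ suc N * qPochhammer (b * q ^ suc s) (suc N))
        ≈⟨ +-cong (trans (qPochhammer-suc (b * q ^ s) N) (*-congˡ (qPochhammer-cong N (solve 3 (λ b q u → b :* u :* q := b :* q :* u) refl b q (q ^ s)))))
                  (-‿cong (*-congˡ (trans (qPochhammer-sucʳ (b * q ^ suc s) N) (*-congʳ (qPochhammer-cong N (sym (*-assoc b q (q ^ s)))))))) ⟩
      (1# + - (b * q ^ s)) * r + - (Q ^ suc N * (r * (1# + - (b * q ^ suc s * q ^ N))))
        -- Beside the common factor r there remains (1 - b u) - q^(-N-1) (1 - b u q^(N+1)) with u =
        -- q^s, where the terms in b cancel; the degree in u drops by one.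
        ≈⟨ solve 7 (λ b q u v V Q r → (:1 :+ :- (b :* u)) :* r :+ :- (Q :* V :* (r :* (:1 :+ :- (b :* (q :* u) :* v))))
             := (:1 :+ :- (Q :* V)) :* r :+ b :* u :* r :* (q :* v :* (Q :* V) :- :1)) refl b q (q ^ s) (q ^ N) (Q ^ N) Q r ⟩
      (1# + - (Q ^ suc N)) * r + b * q ^ s * r * (q ^ suc N * Q ^ suc N - 1#)
        ≈⟨ +-congˡ (*-congˡ (trans (+-congʳ (q^n*Q^n≈1 (suc N))) (-‿inverseʳ 1#))) ⟩
      (1# + - (Q ^ suc N)) * r + b * q ^ s * r * 0#
        ≈⟨ trans (+-congˡ (zeroʳ _)) (+-identityʳ _) ⟩
      (1# + - (Q ^ suc N)) * r ∎
      where
      r : Carrier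
      r = qPochhammer (b * q * q ^ s) N

  x : ℕ → Carrier
  x n = - (a * q ^ n)

  -- The leading coefficient of the ₂φ₁ by which p_n is normalised.
  leading : ℕ → Carrier
  leading n = (- 1#) ^ n * inv (q ^ (n C 2)) * qPochhammer (x n) n

  leading-unit : ∀ n → Unit A (leading n)
  leading-unit n = *-unit
    (*-unit (^-unit n (- 1# , solve 0 (:- :1 :* :- :1 := :1) refl)) (inv-unit (^-unit (n C 2) q-unit)))
    (a-qPochhammer-unit (q ^ n) n)

  -- The power q^l from the argument q x is the one contained in `c`, and the lower parameter 0
  -- gives (0;q)_l = 1.
  p-coeff : ∀ n l → p n l ≈ inv (leading n) * (c n l * qPochhammer (x n) l)
  p-coeff n l = *-congˡ (begin
    qPochhammer (inv (q ^ n)) l * qPochhammer (x n) l * inv (qPochhammer q l * qPochhammer 0# l) * q ^ l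
      ≈⟨ *-congʳ (*-cong (*-congʳ (qPochhammer-cong l (inv-unique (q^n*Q^n≈1 n)))) (sym (inv-cong (q-qPochhammer-unit l) (sym (trans (*-congˡ (qPochhammer-0 l)) (*-identityʳ _)))))) ⟩
    qPochhammer (Q ^ n) l * qPochhammer (x n) l * inv (qPochhammer q l) * q ^ l
      ≈⟨ solve 4 (λ r x i u → r :* x :* i :* u := r :* u :* x :* i) refl (qPochhammer (Q ^ n) l) (qPochhammer (x n) l) (inv (qPochhammer q l)) (q ^ l) ⟩
    qPochhammer (Q ^ n) l * q ^ l * qPochhammer (x n) l * inv (qPochhammer q l)
      ≈⟨ *-congʳ (*-congʳ (c-qPochhammer n l)) ⟩
    c n l * qPochhammer q l * qPochhammer (x n) l * inv (qPochhammer q l)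
      ≈⟨ solve 4 (λ r x i u → r :* u :* x :* i := r :* x :* (u :* i)) refl (c n l) (qPochhammer (x n) l) (inv (qPochhammer q l)) (qPochhammer q l) ⟩
    c n l * qPochhammer (x n) l * (qPochhammer q l * inv (qPochhammer q l))
      ≈⟨ trans (*-congˡ (*-inverse _ (q-qPochhammer-unit l))) (*-identityʳ _) ⟩
    c n l * qPochhammer (x n) l ∎)

  p-upper : ∀ n l → n < l → p n l ≈ 0#
  p-upper n l n<l = trans (p-coeff n l) (trans (*-congˡ (trans (*-congʳ (c-> n l n<l)) (zeroˡ _))) (zeroʳ _))

  -- The top coefficient is the product of the -q^(-i) for i < n, whose exponents add up to the
  -- binomial n over 2. Hence `leading n` is the leading coefficient to be divided out.
  c-diag : ∀ n → c n n ≈ (- 1#) ^ n * inv (q ^ (n C 2))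
  c-diag zero    = sym (trans (*-identityˡ _) (inv-unique (*-identityˡ 1#)))
  c-diag (suc n) = begin
    c n (suc n) + - (Q ^ n * c n n)
      ≈⟨ +-cong (c-> n (suc n) ℕₚ.≤-refl) (-‿cong (*-congˡ (c-diag n))) ⟩
    0# + - (Q ^ n * ((- 1#) ^ n * inv (q ^ (n C 2))))
      ≈⟨ solve 3 (λ v e i → :0 :+ :- (v :* (e :* i)) := :- :1 :* e :* (v :* i)) refl (Q ^ n) ((- 1#) ^ n) (inv (q ^ (n C 2))) ⟩
    (- 1#) ^ suc n * (Q ^ n * inv (q ^ (n C 2)))
      ≈⟨ *-congˡ (inv-unique power) ⟨
    (- 1#) ^ suc n * inv (q ^ (suc n C 2)) ∎
    where
    pascal : suc n C 2 ≡ n ℕ.+ n C 2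
    pascal = ≡.trans (≡.sym (nCk+nC[k+1]≡[n+1]C[k+1] n 1)) (≡.cong (ℕ._+ n C 2) (nC1≡n n))
    power : q ^ (suc n C 2) * (Q ^ n * inv (q ^ (n C 2))) ≈ 1#
    power = begin
      q ^ (suc n C 2) * (Q ^ n * inv (q ^ (n C 2)))            ≡⟨ ≡.cong (λ e → q ^ e * (Q ^ n * inv (q ^ (n C 2)))) pascal ⟩
      q ^ (n ℕ.+ n C 2) * (Q ^ n * inv (q ^ (n C 2)))          ≈⟨ *-congʳ (^-homo-* q n (n C 2)) ⟩
      q ^ n * q ^ (n C 2) * (Q ^ n * inv (q ^ (n C 2)))        ≈⟨ solve 4 (λ u v u′ v′ → u :* v :* (u′ :* v′) := u :* u′ :* (v :* v′)) refl (q ^ n) (q ^ (n C 2)) (Q ^ n) (inv (q ^ (n C 2))) ⟩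
      q ^ n * Q ^ n * (q ^ (n C 2) * inv (q ^ (n C 2)))        ≈⟨ *-cong (q^n*Q^n≈1 n) (*-inverse _ (^-unit (n C 2) q-unit)) ⟩
      1# * 1#                                                  ≈⟨ *-identityˡ 1# ⟩
      1#                                                       ∎

  p-monic : ∀ n → p n n ≈ 1#
  p-monic n = trans (p-coeff n n) (trans (*-congˡ (*-congʳ (c-diag n)))
    (trans (*-comm _ _) (*-inverse (leading n) (leading-unit n))))

  -- The moment h_{m+s,m}.
  h : ℕ → ℕ → Carrier
  h m s = qBinomial (s ℕ.+ m) s * inv (D m s)

  -- Since (q^(-N-m);q)_(s+m) = (q^(-N-m);q)_m (q^(-N);q)_s, everything depending on s reduces to
  -- `c N s`. The factorials (q;q)_s (q;q)_m are multiplied in first and cancelled at the end.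
  c-qBinomial : ∀ N m s → c (N ℕ.+ m) (s ℕ.+ m) * qBinomial (s ℕ.+ m) s
                        ≈ qPochhammer (Q ^ (N ℕ.+ m)) m * q ^ m * inv (qPochhammer q m) * c N s
  c-qBinomial N m s = unit-cancelˡ (*-unit (q-qPochhammer-unit s) (q-qPochhammer-unit m)) _ _ (begin
    rₛ * rₘ * (c (N ℕ.+ m) (s ℕ.+ m) * qBinomial (s ℕ.+ m) s)
      ≈⟨ solve 4 (λ r r′ c b → r :* r′ :* (c :* b) := c :* (b :* (r :* r′))) refl rₛ rₘ (c (N ℕ.+ m) (s ℕ.+ m)) (qBinomial (s ℕ.+ m) s) ⟩
    c (N ℕ.+ m) (s ℕ.+ m) * (qBinomial (s ℕ.+ m) s * (rₛ * rₘ))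
      ≈⟨ *-congˡ (qBinomial-factorial s m) ⟩
    c (N ℕ.+ m) (s ℕ.+ m) * qPochhammer q (s ℕ.+ m)
      ≈⟨ c-qPochhammer (N ℕ.+ m) (s ℕ.+ m) ⟨
    qPochhammer V (s ℕ.+ m) * q ^ (s ℕ.+ m)
      ≈⟨ *-cong (trans (reflexive (≡.cong (qPochhammer V) (ℕₚ.+-comm s m))) (qPochhammer-+ V m s)) (^-homo-* q s m) ⟩
    qPochhammer V m * qPochhammer (V * q ^ m) s * (q ^ s * q ^ m)
      ≈⟨ *-congʳ (*-congˡ (qPochhammer-cong s V*q^m)) ⟩
    qPochhammer V m * qPochhammer (Q ^ N) s * (q ^ s * q ^ m)
      ≈⟨ solve 4 (λ w p u v → w :* p :* (u :* v) := w :* v :* (p :* u)) refl (qPochhammer V m) (qPochhammer (Q ^ N) s) (q ^ s) (q ^ m) ⟩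
    qPochhammer V m * q ^ m * (qPochhammer (Q ^ N) s * q ^ s)
      ≈⟨ *-congˡ (c-qPochhammer N s) ⟩
    qPochhammer V m * q ^ m * (c N s * rₛ)
      ≈⟨ *-congˡ (trans (sym (*-identityˡ _)) (*-congʳ (sym (*-inverse rₘ (q-qPochhammer-unit m))))) ⟩
    qPochhammer V m * q ^ m * (rₘ * inv rₘ * (c N s * rₛ))
      ≈⟨ solve 6 (λ w v r i c r′ → w :* v :* (r :* i :* (c :* r′)) := r′ :* r :* (w :* v :* i :* c)) refl (qPochhammer V m) (q ^ m) rₘ (inv rₘ) (c N s) rₛ ⟩
    rₛ * rₘ * (qPochhammer V m * q ^ m * inv rₘ * c N s) ∎)
    where
    V rₛ rₘ : Carrier
    V = Q ^ (N ℕ.+ m)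
    rₛ = qPochhammer q s
    rₘ = qPochhammer q m
    V*q^m : V * q ^ m ≈ Q ^ N
    V*q^m = begin
      Q ^ (N ℕ.+ m) * q ^ m        ≈⟨ *-congʳ (^-homo-* Q N m) ⟩
      Q ^ N * Q ^ m * q ^ m        ≈⟨ solve 3 (λ u v w → u :* v :* w := u :* (w :* v)) refl (Q ^ N) (Q ^ m) (q ^ m) ⟩
      Q ^ N * (q ^ m * Q ^ m)      ≈⟨ trans (*-congˡ (q^n*Q^n≈1 m)) (*-identityʳ _) ⟩
      Q ^ N                        ∎

  -- With b = `y m 1`, shifting the argument by q^m gives b q^N. The identity (b;q)_N (b q^N;q)_s =
  -- (b;q)_s (b q^s;q)_N then trades the denominator `D m s` for a polynomial of degree N in q^s.
  qPochhammer-D : ∀ N m s → qPochhammer (x (suc N ℕ.+ m)) (s ℕ.+ m) * inv (D m s)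
                          ≈ qPochhammer (x (suc N ℕ.+ m)) m * inv (D m N) * qPochhammer (y m 1 * q ^ s) N
  qPochhammer-D N m s = unit-cancelˡ (*-unit (D-unit m s) (D-unit m N)) _ _ (begin
    D m s * D m N * (qPochhammer z (s ℕ.+ m) * inv (D m s))
      ≈⟨ solve 4 (λ d e w i → d :* e :* (w :* i) := w :* e :* (d :* i)) refl (D m s) (D m N) (qPochhammer z (s ℕ.+ m)) (inv (D m s)) ⟩
    qPochhammer z (s ℕ.+ m) * D m N * (D m s * inv (D m s))
      ≈⟨ *-cong (*-congʳ (trans (reflexive (≡.cong (qPochhammer z) (ℕₚ.+-comm s m))) (trans (qPochhammer-+ z m s) (*-congˡ (qPochhammer-cong s z*q^m))))) (*-inverse _ (D-unit m s)) ⟩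
    qPochhammer z m * qPochhammer (y m 1 * q ^ N) s * D m N * 1#
      ≈⟨ solve 3 (λ w u d → w :* u :* d :* :1 := w :* (d :* u)) refl (qPochhammer z m) (qPochhammer (y m 1 * q ^ N) s) (D m N) ⟩
    qPochhammer z m * (D m N * qPochhammer (y m 1 * q ^ N) s)
      ≈⟨ *-congˡ (trans (sym (qPochhammer-+ (y m 1) N s)) (trans (reflexive (≡.cong (qPochhammer (y m 1)) (ℕₚ.+-comm N s))) (qPochhammer-+ (y m 1) s N))) ⟩
    qPochhammer z m * (D m s * qPochhammer (y m 1 * q ^ s) N)
      ≈⟨ trans (sym (*-identityʳ _)) (*-congˡ (sym (*-inverse _ (D-unit m N)))) ⟩
    qPochhammer z m * (D m s * qPochhammer (y m 1 * q ^ s) N) * (D m N * inv (D m N))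
      ≈⟨ solve 5 (λ w d r e i → w :* (d :* r) :* (e :* i) := d :* e :* (w :* i :* r)) refl (qPochhammer z m) (D m s) (qPochhammer (y m 1 * q ^ s) N) (D m N) (inv (D m N)) ⟩
    D m s * D m N * (qPochhammer z m * inv (D m N) * qPochhammer (y m 1 * q ^ s) N) ∎)
    where
    z : Carrier
    z = x (suc N ℕ.+ m)
    z*q^m : z * q ^ m ≈ y m 1 * q ^ N
    z*q^m = begin
      - (a * (q * q ^ (N ℕ.+ m))) * q ^ m          ≈⟨ *-congʳ (-‿cong (*-congˡ (*-congˡ (^-homo-* q N m)))) ⟩
      - (a * (q * (q ^ N * q ^ m))) * q ^ m        ≈⟨ solve 4 (λ a q u v → :- (a :* (q :* (u :* v))) :* v := :- (a :* (v :* v :* (q :* :1))) :* u) refl a q (q ^ N) (q ^ m) ⟩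
      - (a * (q ^ m * q ^ m * q ^ 1)) * q ^ N      ≈⟨ *-congʳ (-‿cong (*-congˡ (*-congʳ (trans (sym (^-homo-* q m m)) (reflexive (≡.cong (λ e → q ^ (m ℕ.+ e)) (≡.sym (ℕₚ.+-identityʳ m)))))))) ⟩
      y m 1 * q ^ N                                ∎

  -- The bound is any B > N because the terms beyond s = N vanish; thus all matrix entries can share
  -- one truncation.
  ∑-p-h : ∀ N m B → N < B → ∑ B (λ s → p (N ℕ.+ m) (s ℕ.+ m) * h m s) ≈ δ N 0
  ∑-p-h zero m (suc B) _ = begin
    p m m * (1# * inv 1#) + ∑ B (λ s → p m (suc s ℕ.+ m) * h m (suc s))
      ≈⟨ +-cong (*-cong (p-monic m) (trans (*-identityˡ _) (inv-unique (*-identityˡ 1#))))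
                (∑-zero B λ s _ → trans (*-congʳ (p-upper m (suc s ℕ.+ m) (s≤s (ℕₚ.m≤n+m m s)))) (zeroˡ (h m (suc s)))) ⟩
    1# * 1# + 0#  ≈⟨ trans (+-identityʳ _) (*-identityˡ _) ⟩
    1#            ∎
  ∑-p-h (suc N) m B N<B = begin
    ∑ B (λ s → p n (s ℕ.+ m) * h m s)
      ≈⟨ ∑-cong B (λ s _ → term s) ⟩
    ∑ B (λ s → κ * (c (suc N) s * qPochhammer (y m 1 * q ^ s) N))
      ≈⟨ ∑-*ˡ B κ (λ s → c (suc N) s * qPochhammer (y m 1 * q ^ s) N) ⟩
    κ * ∑ B (λ s → c (suc N) s * qPochhammer (y m 1 * q ^ s) N)
      ≈⟨ *-congˡ (trans (sym (Δ-∑ (suc N) B (λ s → qPochhammer (y m 1 * q ^ s) N) N<B)) (Δ-qPochhammer N (y m 1))) ⟩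
    κ * 0#
      ≈⟨ zeroʳ κ ⟩
    0# ∎
    where
    n : ℕ
    n = suc N ℕ.+ m
    κ₁ κ₂ κ : Carrier
    κ₁ = qPochhammer (Q ^ n) m * q ^ m * inv (qPochhammer q m)
    κ₂ = qPochhammer (x n) m * inv (D m N)
    κ = inv (leading n) * (κ₁ * κ₂)
    term : ∀ s → p n (s ℕ.+ m) * h m s ≈ κ * (c (suc N) s * qPochhammer (y m 1 * q ^ s) N)
    term s = begin
      p n (s ℕ.+ m) * (qBinomial (s ℕ.+ m) s * inv (D m s))
        ≈⟨ *-congʳ (p-coeff n (s ℕ.+ m)) ⟩
      inv (leading n) * (c n (s ℕ.+ m) * qPochhammer (x n) (s ℕ.+ m)) * (qBinomial (s ℕ.+ m) s * inv (D m s))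
        ≈⟨ solve 5 (λ l c w b i → l :* (c :* w) :* (b :* i) := l :* (c :* b :* (w :* i))) refl (inv (leading n)) (c n (s ℕ.+ m)) (qPochhammer (x n) (s ℕ.+ m)) (qBinomial (s ℕ.+ m) s) (inv (D m s)) ⟩
      inv (leading n) * (c n (s ℕ.+ m) * qBinomial (s ℕ.+ m) s * (qPochhammer (x n) (s ℕ.+ m) * inv (D m s)))
        ≈⟨ *-congˡ (*-cong (c-qBinomial (suc N) m s) (qPochhammer-D N m s)) ⟩
      inv (leading n) * (κ₁ * c (suc N) s * (κ₂ * qPochhammer (y m 1 * q ^ s) N))
        ≈⟨ solve 5 (λ l u c v w → l :* (u :* c :* (v :* w)) := l :* (u :* v) :* (c :* w)) refl (inv (leading n)) κ₁ (c (suc N) s) κ₂ (qPochhammer (y m 1 * q ^ s) N) ⟩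
      κ * (c (suc N) s * qPochhammer (y m 1 * q ^ s) N) ∎

  h-column : ℕ → ℕ → Carrier
  h-column m l with m ℕₚ.≤? l
  ... | yes _ = h m (l ∸ m)
  ... | no  _ = 0#

  h-column-≥ : ∀ m s → h-column m (s ℕ.+ m) ≈ h m s
  h-column-≥ m s with m ℕₚ.≤? (s ℕ.+ m)
  ... | yes _ = reflexive (≡.cong (h m) (ℕₚ.m+n∸n≡m s m))
  ... | no ¬p = contradiction (ℕₚ.m≤n+m m s) ¬p

  h-column-< : ∀ m l → l < m → h-column m l ≈ 0#
  h-column-< m l l<m with m ℕₚ.≤? l
  ... | yes m≤l = contradiction m≤l (ℕₚ.<⇒≱ l<m)
  ... | no  _   = refl

  p-h-inverse : ∀ B m n → m < B → n < B → ∑ B (λ l → p n l * h-column m l) ≈ δ m n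
  p-h-inverse B m n m<B n<B = begin
    ∑ B (λ l → p n l * h-column m l)
      ≡⟨ ≡.cong (λ b → ∑ b (λ l → p n l * h-column m l)) (ℕₚ.m+[n∸m]≡n (ℕₚ.<⇒≤ m<B)) ⟨
    ∑ (m ℕ.+ (B ∸ m)) (λ l → p n l * h-column m l)
      ≈⟨ ∑-split m (B ∸ m) (λ l → p n l * h-column m l) ⟩
    ∑ m (λ l → p n l * h-column m l) + ∑ (B ∸ m) (λ s → p n (m ℕ.+ s) * h-column m (m ℕ.+ s))
      ≈⟨ +-cong (∑-zero m λ l l<m → trans (*-congˡ (h-column-< m l l<m)) (zeroʳ (p n l)))
                (∑-cong (B ∸ m) λ s _ → trans (reflexive (≡.cong (λ l → p n l * h-column m l) (ℕₚ.+-comm m s))) (*-congˡ (h-column-≥ m s))) ⟩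
    0# + ∑ (B ∸ m) (λ s → p n (s ℕ.+ m) * h m s)
      ≈⟨ trans (+-identityˡ _) sum-from-m ⟩
    δ m n ∎
    where
    sum-from-m : ∑ (B ∸ m) (λ s → p n (s ℕ.+ m) * h m s) ≈ δ m n
    sum-from-m with m ℕₚ.≤? n
    ... | no  m≰n = trans
      (∑-zero (B ∸ m) λ s _ → trans (*-congʳ (p-upper n (s ℕ.+ m) (ℕₚ.<-≤-trans (ℕₚ.≰⇒> m≰n) (ℕₚ.m≤n+m m s)))) (zeroˡ (h m s)))
      (sym (δ-≢ m n λ m≡n → m≰n (ℕₚ.≤-reflexive m≡n)))
    ... | yes m≤n = begin
      ∑ (B ∸ m) (λ s → p n (s ℕ.+ m) * h m s)
        ≡⟨ ≡.cong (λ i → ∑ (B ∸ m) (λ s → p i (s ℕ.+ m) * h m s)) (ℕₚ.m∸n+n≡m m≤n) ⟨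
      ∑ (B ∸ m) (λ s → p (n ∸ m ℕ.+ m) (s ℕ.+ m) * h m s)
        ≈⟨ ∑-p-h (n ∸ m) m (B ∸ m) (ℕₚ.∸-monoˡ-< n<B m≤n) ⟩
      δ (n ∸ m) 0
        ≈⟨ δ-∸ m n m≤n ⟩
      δ m n ∎
      where
      δ-∸ : ∀ m n → m ≤ n → δ (n ∸ m) 0 ≈ δ m n
      δ-∸ zero    zero    _         = refl
      δ-∸ zero    (suc n) _         = refl
      δ-∸ (suc m) (suc n) (s≤s m≤n) = δ-∸ m n m≤n

  -- Let P be the coefficient matrix of the polynomials and H that of the candidate moments. The
  -- hypothesis reads σP = 1, so σ = σ(PH) = (σP)H = H. The expansion of x^n stops at index n and P
  -- is lower triangular, so truncation at n + 1 is exact in row n.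
  mixedMoments-unique : ∀ σ → IsMixedMoments σ → ∀ n k → k ≤ n → σ n k ≈ h-column k n
  mixedMoments-unique σ σ-moments n k k≤n = begin
    σ n k
      ≈⟨ ∑-δ B k (σ n) (s≤s k≤n) ⟨
    ∑ B (λ i → σ n i * δ k i)
      ≈⟨ ∑-cong B (λ i i<B → *-congˡ {σ n i} (sym (p-h-inverse B k i (s≤s k≤n) i<B))) ⟩
    ∑ B (λ i → σ n i * ∑ B (λ l → p i l * h-column k l))
      ≈⟨ ∑-cong B (λ i _ → trans (sym (∑-*ˡ B (σ n i) (λ l → p i l * h-column k l))) (∑-cong B λ l _ → sym (*-assoc (σ n i) (p i l) (h-column k l)))) ⟩
    ∑ B (λ i → ∑ B (λ l → σ n i * p i l * h-column k l))
      ≈⟨ ∑-swap B B (λ i l → σ n i * p i l * h-column k l) ⟩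
    ∑ B (λ l → ∑ B (λ i → σ n i * p i l * h-column k l))
      ≈⟨ ∑-cong B (λ l _ → trans (∑-*ʳ B (h-column k l) (λ i → σ n i * p i l)) (trans (*-congʳ (coefficient l)) (*-comm (δ n l) (h-column k l)))) ⟩
    ∑ B (λ l → h-column k l * δ n l)
      ≈⟨ ∑-δ B n (h-column k) ℕₚ.≤-refl ⟩
    h-column k n ∎
    where
    B : ℕ
    B = suc n
    coefficient : ∀ l → ∑ B (λ i → σ n i * p i l) ≈ δ n l
    coefficient l = trans (sym (∑-coeff B (σ n) p l)) (trans (sym (σ-moments n l)) (X^-coeff n l))

  pathSumAt : ℕ → ℕ → ℕ → ℕ → Carrier
  pathSumAt k t i j = pathSum k t (i ∸ k) j (i ∸ j)

  pathSumAt-rest : ∀ k t j → pathSumAt k t k j ≈ 1#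
  pathSumAt-rest k t j rewrite ℕₚ.n∸n≡0 k = pathSum-rest k t j (k ∸ j)

  pathSumAt-step : ∀ k t d j → j ≤ d ℕ.+ k → pathSumAt k t (suc d ℕ.+ k) j ≈
    pathSumAt k t (suc d ℕ.+ k) (suc j) + ((- (a * q ^ (2 ℕ.* (d ℕ.+ k) ℕ.+ 1))) ^ t * q ^ j) * pathSumAt k t (d ℕ.+ k) j
  pathSumAt-step k t d j j≤i
    rewrite ℕₚ.m+n∸n≡m (suc d) k | ℕₚ.m+n∸n≡m d k | ℕₚ.+-∸-assoc 1 j≤i
    = pathSum-step k t d j (d ℕ.+ k ∸ j)

  pathSumAt-wrap : ∀ k t i → pathSumAt k t i i ≈ pathSumAt k (suc t) i 0
  pathSumAt-wrap k t i rewrite ℕₚ.n∸n≡0 i = pathSum-wrap k t (i ∸ k) i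

  -- To the right of column k the exponent m is positive, so every level contributes a factor a. The
  -- cofactors stay anonymous; divisibility by a^t is what is read off.
  pathSumAt-power : ∀ k t d j → ∃ λ u → ∃ λ r → pathSumAt k t (suc d ℕ.+ k) j ≈ (- (a * u)) ^ t * r
  pathSumAt-power k t d j rewrite ℕₚ.m+n∸n≡m (suc d) k = _ , _ , *-congʳ (^-congˡ t
    (solve 3 (λ a u v → :- (a :* u) :* v := :- (a :* (u :* v))) refl a (q ^ (2 ℕ.* k) * q ^ suc d) (y k (suc d) ^ d)))

  mixedMoments-pathSum : ∀ σ → IsMixedMoments σ → ∀ n k → k ≤ n → σ n k ≈ pathSumAt k 0 n 0
  mixedMoments-pathSum σ σ-moments n k k≤n = trans (mixedMoments-unique σ σ-moments n k k≤n) h-column-pathSum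
    where
    h-column-pathSum : h-column k n ≈ pathSumAt k 0 n 0
    h-column-pathSum with k ℕₚ.≤? n
    ... | no  k≰n = contradiction k≤n k≰n
    ... | yes _   = trans
      (reflexive (≡.cong (λ i → qBinomial i (n ∸ k) * inv (D k (n ∸ k))) (ℕₚ.m∸n+n≡m k≤n)))
      (sym (*-identityˡ _))

-- Specialisation to power series, where units are detected by constant terms

module BesselPaths (raw : RawRing 0ℓ 0ℓ) (laws : RingLaws raw)
  (_⁻¹′ : RawRing.Carrier raw → RawRing.Carrier raw) (*-inverse′ : InvertsUnits (bundle raw laws) _⁻¹′)
  (a q : PowerSeries.Series raw) (a₀≈0 : RawRing._≈_ raw (a 0) (RawRing.0# raw))
  (q₀-unit : Unit (bundle raw laws) (q 0)) (1-q₀^-unit : UnitDifferences (bundle raw laws) (q 0))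
  where

  private
    R : CommutativeRing 0ℓ 0ℓ
    R = bundle raw laws
  open CommutativeRing R hiding (zero; rawRing; isCommutativeRing)
  open RawSemiringOps (RawRing.rawSemiring raw) using (_^_)
  open PowerSeries raw using (Series; inverse; rawRing)
  open PowerSeriesRing raw laws
  open Inverse _⁻¹′ *-inverse′
  open Units R using (unit-resp; 1-unit)
  private
    module S = CommutativeRing commutativeRing
  open RawSemiringOps (RawRing.rawSemiring rawRing) using () renaming (_^_ to _^ˢ_)

  constant-term-q^ : ∀ i → (q ^ˢ i) 0 ≈ q 0 ^ i
  constant-term-q^ zero    = refl
  constant-term-q^ (suc i) = trans (⊛-zero q (q ^ˢ i)) (*-congˡ (constant-term-q^ i))

  q-unit : Unit commutativeRing q
  q-unit = Unit-⊛ q q₀-unit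

  1-q^-unit : ∀ i → Unit commutativeRing (S.1# S.+ S.- (q S.* q ^ˢ i))
  1-q^-unit i = Unit-⊛ (S.1# S.+ S.- (q S.* q ^ˢ i)) (unit-resp (sym (+-congˡ (-‿cong (constant-term-q^ (suc i))))) (1-q₀^-unit i))

  -- As a has no constant term, 1 + a z has constant term 1.
  1+a-unit : ∀ z → Unit commutativeRing (S.1# S.+ a S.* z)
  1+a-unit z = Unit-⊛ (S.1# S.+ a S.* z) (unit-resp
    (sym (trans (+-congˡ (trans (⊛-zero a z) (trans (*-congʳ a₀≈0) (zeroˡ (z 0))))) (+-identityʳ 1#))) 1-unit)

  open MixedMoments rawRing isCommutativeRing (inverse _⁻¹′) inverse-Unit a q q-unit 1-q^-unit 1+a-unit
  open QBessel rawRing (inverse _⁻¹′) a q using (besselWeight; IsMixedMoments)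
  open Weights rawRing using (pathWeight)
  open Summation raw using (HasSum)

  Order-- : ∀ {t} f → Order t f → Order t (S.- f)
  Order-- f f-order n n<t = trans (-‿cong (f-order n n<t)) -0#≈0#
    where
    open import Algebra.Properties.Ring ring using (-0#≈0#)

  Order-^₁ : ∀ {f} t → Order 1 f → Order t (f ^ˢ t)
  Order-^₁ {f} t f-order n n<t = Order-^ {1} {f} t f-order n
    (ℕₚ.<-≤-trans n<t (ℕₚ.≤-reflexive (≡.sym (ℕₚ.*-identityʳ t))))

  -a*-order : ∀ z → Order 1 (S.- (a S.* z))
  -a*-order z = Order-- (a S.* z) (Order-⊛ˡ {1} {a} z λ { zero _ → a₀≈0 ; (suc _) (s≤s ()) })

  besselWeight-order : ∀ v → Order (Vertex.t v) (besselWeight v)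
  besselWeight-order ⟨ t , i , j ⟩ = Order-⊛ˡ (q ^ˢ j) (Order-^₁ t (-a*-order (q ^ˢ (2 ℕ.* i ℕ.+ 1))))

  pathSumAt-order : ∀ k t d j → Order t (pathSumAt k t (suc d ℕ.+ k) j)
  pathSumAt-order k t d j n n<t = order (pathSumAt-power k t d j)
    where
    order : (∃ λ u → ∃ λ r → pathSumAt k t (suc d ℕ.+ k) j S.≈ (S.- (a S.* u)) ^ˢ t S.* r) →
            pathSumAt k t (suc d ℕ.+ k) j n ≈ 0#
    order (u , r , eq) = trans (eq n) (Order-⊛ˡ r (Order-^₁ t (-a*-order u)) n n<t)

  HasSum-resp : ∀ {I f s s′} → s′ S.≈ s → HasSum I f s → HasSum I f s′
  HasSum-resp s′≈s Σf m = proj₁ (Σf m) , proj₁ (proj₂ (Σf m)) , proj₁ (proj₂ (proj₂ (Σf m)))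
    , trans (s′≈s m) (proj₂ (proj₂ (proj₂ (Σf m))))

  moments-hasSum : ∀ σ → IsMixedMoments σ → ∀ n k → k ≤ n → HasSum (SE-setoid k n) (pathWeight besselWeight) (σ n k)
  moments-hasSum σ σ-moments n k k≤n = HasSum-resp {SE-setoid k n} {pathWeight besselWeight} {pathSumAt k 0 n 0} {σ n k}
    (mixedMoments-pathSum σ σ-moments n k k≤n)
    (PathSums.hasSum raw laws k besselWeight besselWeight-order (pathSumAt k)
      (pathSumAt-rest k)
      (λ t d j j≤i → pathSumAt-step k t d j (recompute (j ℕₚ.≤? (d ℕ.+ k)) j≤i))
      (λ t d → pathSumAt-wrap k t (suc d ℕ.+ k))
      (pathSumAt-order k) n k≤n)

proposition4p8 : (σ : ℕ → ℕ → ℚ⟨q⟩⟦a⟧.Series) → ℚ⟨q⟩⟦a⟧.IsMixedMoments σ →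
    ∀ (n k : ℕ) → k ≤ n →
    ℚ⟨q⟩⟦a⟧.h[ ℚ⟨q⟩⟦a⟧.besselWeight , n , k ]≡ (σ n k)
proposition4p8 = BesselPaths.moments-hasSum ℚ⟨q⟩-rawRing ℚ⟨q⟩-laws _⁻¹ *-inverse
  ℚ⟨q⟩⟦a⟧.a ℚ⟨q⟩⟦a⟧.q (CommutativeRing.refl ℚ⟨q⟩-commutativeRing {fromPoly 0ₚ}) qᶠ-unit 1-qᶠ^-unit
  where
  open RationalFunctions
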